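{- There is an absolute constant $c>0$ such that the following holds for all positive integers $n$ and $k$ and every $\varepsilon<1/10$: if there is a $\mathrm{MAJ}_k\circ\mathrm{MAJ}_k$ circuit on the variables $x_1,\dots,x_n$ that computes $\mathrm{MAJ}_n$ correctly on at least a $(1-\varepsilon)$ fraction of all minterms and maxterms of $\mathrm{MAJ}_n$ (counted together), then $k\ge c\, n^{2/3}$.
   Context: $\mathrm{MAJ}_n(x_1,\dots,x_n)=1$ if $\sum_{i=1}^n x_i\ge n/2$, and $0$ otherwise. An assignment $A\in\{0,1\}^n$ is a minterm of $\mathrm{MAJ}_n$ if $\mathrm{MAJ}_n(A)=1$ but flipping any $1$ of $A$ to $0$ gives an assignment $A'$ with $\mathrm{MAJ}_n(A')=0$. It is a maxterm if $\mathrm{MAJ}_n(A)=0$ but flipping any $0$ of $A$ to $1$ gives an assignment $A'$ with $\mathrm{MAJ}_n(A')=1$. For a positive integer $k$, a $\mathrm{MAJ}_k\circ\mathrm{MAJ}_k$ circuit on $x_1,\dots,x_n$ is a depth two formula with a single top gate whose inputs are bottom-level gates, the inputs of each bottom-level gate being variables among $x_1,\dots,x_n$. Every gate (top and bottom) is a threshold gate: with inputs $z_1,\dots,z_r$ it outputs $1$ if $\sum_i c_i z_i\ge t$ and $0$ otherwise, where the weights $c_i$ are positive integers with $\sum_i c_i\le k$ and $t$ is an arbitrary integer threshold (weights and thresholds may differ from gate to gate). A weight $c_i$ can equivalently be seen as repeating the input $z_i$ $c_i$ times. -}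

module Defs where

open import Algebra.Properties.Semiring.Sum using (sum)
open import Algebra.Definitions.RawSemiring using () renaming (_^_ to pow)
open import Data.Bool.Base using (Bool; true; false; if_then_else_)
open import Data.Bool.Properties using () renaming (_≟_ to _≟ᵇ_)
open import Data.Fin.Base using (Fin)
open import Data.Fin.Properties using (all?)
open import Data.Integer.Base as ℤ using (ℤ; +_)
open import Data.Integer.Properties using () renaming (_≤?_ to _≤ℤ?_)
open import Data.List.Base using (List; []; _∷_; cartesianProductWith; filter; length)
open import Data.Nat.Base using (ℕ; zero; suc; _≤_; _<_; _*_)
open import Data.Nat.Properties using (_≤?_; +-*-semiring)
open import Data.Product.Base using (_×_)
open import Data.Rational.Base as ℚ using (ℚ; _/_)
open import Data.Sum.Base using (_⊎_)
open import Data.Vec.Base using (Vec; []; _∷_; lookup; _[_]≔_)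
open import Relation.Binary.PropositionalEquality.Core using (_≡_)
open import Relation.Nullary.Decidable using (⌊_⌋; _×-dec_; _→-dec_; _⊎-dec_)
open import Relation.Unary using (Pred; Decidable)

Σℕ : ∀ {r} → (Fin r → ℕ) → ℕ
Σℕ = sum +-*-semiring

bit : Bool → ℕ
bit b = if b then 1 else 0

Assignment : ℕ → Set
Assignment n = Vec Bool n

-- x₁ + … + xₙ ≥ n/2, with the denominator cleared.
MAJ : ∀ {n} → Assignment n → Bool
MAJ {n} A = ⌊ n ≤? 2 * Σℕ (λ i → bit (lookup A i)) ⌋

IsMinterm : ∀ {n} → Pred (Assignment n) _
IsMinterm A =
  MAJ A ≡ true × (∀ i → lookup A i ≡ true → MAJ (A [ i ]≔ false) ≡ false)

IsMaxterm : ∀ {n} → Pred (Assignment n) _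
IsMaxterm A =
  MAJ A ≡ false × (∀ i → lookup A i ≡ false → MAJ (A [ i ]≔ true) ≡ true)

isMinterm? : ∀ {n} → Decidable (IsMinterm {n})
isMinterm? A = (MAJ A ≟ᵇ true) ×-dec
  all? (λ i → (lookup A i ≟ᵇ true) →-dec (MAJ (A [ i ]≔ false) ≟ᵇ false))

isMaxterm? : ∀ {n} → Decidable (IsMaxterm {n})
isMaxterm? A = (MAJ A ≟ᵇ false) ×-dec
  all? (λ i → (lookup A i ≟ᵇ false) →-dec (MAJ (A [ i ]≔ true) ≟ᵇ true))

-- A threshold gate of total weight at most k, whose inputs are drawn from I.
record Gate (k : ℕ) (I : Set) : Set where
  field
    arity     : ℕ
    input     : Fin arity → I
    weight    : Fin arity → ℕ
    weight>0  : ∀ i → 0 < weight i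
    weight≤k  : Σℕ weight ≤ k
    threshold : ℤ

evalGate : ∀ {k I} → (I → Bool) → Gate k I → Bool
evalGate val g = ⌊ threshold ≤ℤ? + Σℕ (λ i → weight i * bit (val (input i))) ⌋
  where open Gate g

MAJ∘MAJ-Circuit : (k n : ℕ) → Set
MAJ∘MAJ-Circuit k n = Gate k (Gate k (Fin n))

evalCircuit : ∀ {k n} → MAJ∘MAJ-Circuit k n → Assignment n → Bool
evalCircuit C A = evalGate (evalGate (lookup A)) C

-- Every element of {0,1}ⁿ, exactly once.
assignments : ∀ n → List (Assignment n)
assignments zero    = [] ∷ []
assignments (suc n) = cartesianProductWith _∷_ (false ∷ true ∷ []) (assignments n)

minMaxTerms : ∀ n → List (Assignment n)
minMaxTerms n = filter (λ A → isMinterm? A ⊎-dec isMaxterm? A) (assignments n)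

correctTerms : ∀ {k n} → MAJ∘MAJ-Circuit k n → List (Assignment n)
correctTerms {n = n} C = filter (λ A → evalCircuit C A ≟ᵇ MAJ A) (minMaxTerms n)

ℕ→ℚ : ℕ → ℚ
ℕ→ℚ m = + m / 1

_computesMAJOnFraction_ : ∀ {k n} → MAJ∘MAJ-Circuit k n → ℚ → Set
_computesMAJOnFraction_ {n = n} C δ =
  δ ℚ.* ℕ→ℚ (length (minMaxTerms n)) ℚ.≤ ℕ→ℚ (length (correctTerms C))

infixr 8 _^ℚ_
_^ℚ_ : ℚ → ℕ → ℚ
_^ℚ_ = pow ℚ.+-*-rawSemiring

-- k ≥ c · n^{2/3} with both (nonnegative) sides cubed, since the right-hand
-- side need not be rational.  Only meaningful for c ≥ 0.
_≥_·_^⅔ : ℕ → ℚ → ℕ → Set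
k ≥ c · n ^⅔ = c ^ℚ 3 ℚ.* ℕ→ℚ n ^ℚ 2 ℚ.≤ ℕ→ℚ k ^ℚ 3

{-# OPTIONS --safe #-}
module Submission where

-- Call an edge of the cube between a minterm A and the maxterm A \ i sensitive for
-- a monotone φ if φ changes along it.  There are about nN/4 edges, where N is the
-- number of minterms and maxterms.  A circuit that is right on most of these terms is
-- sensitive on a constant fraction of the edges, and on each of them one of its (at
-- most k) bottom gates is sensitive.  On the other hand a monotone φ depending only on
-- a set S of r ≤ n/2 variables is sensitive on O(√r N) edges: with the centred weights
-- yᵢ = n [i ∈ S] - r, double counting gives
--   (n - r) · #sensitive = Σ_A φ(A) ⟨y,A⟩ + Σ_B φ(B) ⟨y,B⟩
-- (A over minterms, B over maxterms), and ⟨y,·⟩² has mean at most n r (n - r) / 2 on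
-- either layer.  Hence n = O(k √k).  Square roots are avoided by using
-- 2μν⟨y,A⟩ ≤ μ² + ν²⟨y,A⟩² with μ = n² and ν = 20k in place of Cauchy–Schwarz.

open import Algebra.Properties.Semiring.Sum using ()
open import Data.Bool.Base using (Bool; true; false; _∨_)
open import Data.Bool.Properties using () renaming (_≟_ to _≟ᵇ_)
open import Data.Fin.Base using (Fin; zero; suc)
open import Data.Fin.Properties using (_≟_; any?; all?; ¬∀⟶∃¬)
open import Data.Integer.Base as ℤ using (+_)
import Data.Integer.Properties as ℤ
open import Data.Integer.Tactic.RingSolver using (solve-∀)
open import Data.List.Base using (List; []; _∷_; _++_; map; filter; length)
open import Data.Nat.Base as ℕ using (ℕ; NonZero; zero; suc; z≤n; s≤s)
import Data.Nat.Properties as ℕ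
open import Data.Product.Base using (_×_; _,_; Σ-syntax; ∃-syntax; proj₁; proj₂)
open import Data.Sum.Base using ([_,_]′)
open import Data.Vec.Base using ([]; _∷_; lookup; _[_]≔_)
open import Data.Vec.Functional using (tail)
open import Data.Vec.Properties using (lookup∘update; lookup∘update′)
open import Function.Base using (_∘_)
open import Function.Bundles using (_⇔_; mk⇔)
open import Relation.Binary.PropositionalEquality.Core
  using (_≡_; _≢_; refl; sym; trans; cong; cong₂; subst; subst₂)
open import Relation.Binary.PropositionalEquality.Properties using (module ≡-Reasoning)
open import Relation.Nullary.Decidable
  using (Dec; yes; no; ⌊_⌋; does; _×-dec_; _⊎-dec_; does-⇔; from-yes)
open import Relation.Nullary.Negation using (contradiction; ¬_)
open import Relation.Unary using (Decidable)
open import Defs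

module Counting where

  open import Data.Integer.Base using
    (ℤ; -[1+_]; 0ℤ; 1ℤ; _+_; _-_; -_; _*_; _≤_; _<_; +≤+; -≤+; +<+; positive; nonNegative)
  open Algebra.Properties.Semiring.Sum ℤ.+-*-semiring
    using (sum; sum-cong-≗; ∑-distrib-+; ∑-comm; *-distribˡ-sum)
  module Σℕ = Algebra.Properties.Semiring.Sum ℕ.+-*-semiring

  private variable
    k n : ℕ
    I X Y : Set

  -- Integer inequalities and sums over the cube.

  χ : Bool → ℤ
  χ b = + bit b

  ∣_∣ : Assignment n → ℕ
  ∣ A ∣ = Σℕ (λ i → bit (lookup A i))

  -- Reduces a polynomial inequality to a ring identity, which `solve-∀` settles, and the
  -- nonnegativity of an explicit difference `d`.
  certify-≤ : ∀ {i j d} → j ≡ i + d → 0ℤ ≤ d → i ≤ j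
  certify-≤ {i} {j} {d} eq 0≤d = subst₂ _≤_ (ℤ.+-identityʳ i) (sym eq) (ℤ.+-monoʳ-≤ i 0≤d)

  *-nonNeg : ∀ {i j} → 0ℤ ≤ i → 0ℤ ≤ j → 0ℤ ≤ i * j
  *-nonNeg {i} {j} 0≤i 0≤j =
    subst (_≤ i * j) (ℤ.*-zeroʳ i) (ℤ.*-monoˡ-≤-nonNeg i {{nonNegative 0≤i}} 0≤j)

  square-nonNeg : ∀ i → 0ℤ ≤ i * i
  square-nonNeg (+ m) = *-nonNeg {+ m} (+≤+ z≤n) (+≤+ z≤n)
  square-nonNeg -[1+ m ] = +≤+ z≤n

  -- Opaque, so that goals stay phrased in terms of `∑ᶜ`; outside the block its recursion is
  -- available only through `∑ᶜ-[]` and `∑ᶜ-∷`.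
  opaque
    ∑ᶜ : (Assignment n → ℤ) → ℤ
    ∑ᶜ {zero}  F = F []
    ∑ᶜ {suc n} F = ∑ᶜ (λ A → F (false ∷ A)) + ∑ᶜ (λ A → F (true ∷ A))

    ∑ᶜ-[] : (F : Assignment 0 → ℤ) → ∑ᶜ F ≡ F []
    ∑ᶜ-[] F = refl

    ∑ᶜ-∷ : (F : Assignment (suc n) → ℤ) →
      ∑ᶜ F ≡ ∑ᶜ (λ A → F (false ∷ A)) + ∑ᶜ (λ A → F (true ∷ A))
    ∑ᶜ-∷ F = refl

    ∑ᶜ-cong : {F G : Assignment n → ℤ} → (∀ A → F A ≡ G A) → ∑ᶜ F ≡ ∑ᶜ G
    ∑ᶜ-cong {zero}  F≗G = F≗G []
    ∑ᶜ-cong {suc n} F≗G = cong₂ _+_ (∑ᶜ-cong (λ A → F≗G (false ∷ A))) (∑ᶜ-cong (λ A → F≗G (true ∷ A)))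

    ∑ᶜ-mono : {F G : Assignment n → ℤ} → (∀ A → F A ≤ G A) → ∑ᶜ F ≤ ∑ᶜ G
    ∑ᶜ-mono {zero}  F≤G = F≤G []
    ∑ᶜ-mono {suc n} F≤G = ℤ.+-mono-≤ (∑ᶜ-mono (λ A → F≤G (false ∷ A))) (∑ᶜ-mono (λ A → F≤G (true ∷ A)))

    ∑ᶜ-+ : (F G : Assignment n → ℤ) → ∑ᶜ (λ A → F A + G A) ≡ ∑ᶜ F + ∑ᶜ G
    ∑ᶜ-+ {zero}  F G = refl
    ∑ᶜ-+ {suc n} F G = trans
      (cong₂ _+_ (∑ᶜ-+ (λ A → F (false ∷ A)) (λ A → G (false ∷ A)))
                 (∑ᶜ-+ (λ A → F (true ∷ A)) (λ A → G (true ∷ A))))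
      (interchange (∑ᶜ (λ A → F (false ∷ A))) (∑ᶜ (λ A → G (false ∷ A)))
                   (∑ᶜ (λ A → F (true ∷ A))) (∑ᶜ (λ A → G (true ∷ A))))
      where
      interchange : ∀ a b c d → a + b + (c + d) ≡ a + c + (b + d)
      interchange = solve-∀

    ∑ᶜ-* : ∀ c (F : Assignment n → ℤ) → ∑ᶜ (λ A → c * F A) ≡ c * ∑ᶜ F
    ∑ᶜ-* {zero}  c F = refl
    ∑ᶜ-* {suc n} c F = trans
      (cong₂ _+_ (∑ᶜ-* c (λ A → F (false ∷ A))) (∑ᶜ-* c (λ A → F (true ∷ A))))
      (sym (ℤ.*-distribˡ-+ c (∑ᶜ (λ A → F (false ∷ A))) (∑ᶜ (λ A → F (true ∷ A)))))

  ∑ᶜ-- : (F G : Assignment n → ℤ) → ∑ᶜ (λ A → F A - G A) ≡ ∑ᶜ F - ∑ᶜ G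
  ∑ᶜ-- F G = begin
    ∑ᶜ (λ A → F A - G A)             ≡⟨ ∑ᶜ-cong (λ A → neg (F A) (G A)) ⟩
    ∑ᶜ (λ A → F A + - 1ℤ * G A)      ≡⟨ ∑ᶜ-+ F _ ⟩
    ∑ᶜ F + ∑ᶜ (λ A → - 1ℤ * G A)     ≡⟨ cong (λ z → ∑ᶜ F + z) (∑ᶜ-* (- 1ℤ) G) ⟩
    ∑ᶜ F + - 1ℤ * ∑ᶜ G               ≡⟨ neg (∑ᶜ F) (∑ᶜ G) ⟨
    ∑ᶜ F - ∑ᶜ G                      ∎
    where
    open ≡-Reasoning
    neg : ∀ x y → x - y ≡ x + - 1ℤ * y
    neg = solve-∀

  ∑ᶜ-zero : ∀ n → ∑ᶜ {n} (λ _ → 0ℤ) ≡ 0ℤ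
  ∑ᶜ-zero n = ∑ᶜ-* {n} 0ℤ (λ _ → 0ℤ)

  ∑ᶜ-sum : ∀ {m} (F : Fin m → Assignment n → ℤ) →
    ∑ᶜ (λ A → sum (λ i → F i A)) ≡ sum (λ i → ∑ᶜ (F i))
  ∑ᶜ-sum {n = n} {zero}  F = ∑ᶜ-zero n
  ∑ᶜ-sum {m = suc m} F = trans (∑ᶜ-+ (F zero) _) (cong (_+_ (∑ᶜ (F zero))) (∑ᶜ-sum (F ∘ suc)))

  ∑ᶜ-nonNeg : {F : Assignment n → ℤ} → (∀ A → 0ℤ ≤ F A) → 0ℤ ≤ ∑ᶜ F
  ∑ᶜ-nonNeg {n} {F} 0≤F = subst (λ z → z ≤ ∑ᶜ F) (∑ᶜ-zero n) (∑ᶜ-mono 0≤F)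

  sum-mono : ∀ {m} {f g : Fin m → ℤ} → (∀ i → f i ≤ g i) → sum f ≤ sum g
  sum-mono {zero}  f≤g = ℤ.≤-refl
  sum-mono {suc m} f≤g = ℤ.+-mono-≤ (f≤g zero) (sum-mono (f≤g ∘ suc))

  sum-const : ∀ m c → sum {m} (λ _ → c) ≡ + m * c
  sum-const zero    c = sym (ℤ.*-zeroˡ c)
  sum-const (suc m) c = trans (cong (_+_ c) (sum-const m c)) (sym (ℤ.suc-* (+ m) c))

  sum-nonNeg : {f : Fin n → ℤ} → (∀ i → 0ℤ ≤ f i) → 0ℤ ≤ sum f
  sum-nonNeg {n} {f} 0≤f = subst (λ z → z ≤ sum f)
    (trans (sum-const n 0ℤ) (ℤ.*-zeroʳ (+ n))) (sum-mono 0≤f)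

  -- Layers of the cube and moments of linear forms on them.

  shift : (ℕ → ℤ) → ℕ → ℤ
  shift w j = w (suc j)

  -- This is the sum of binomial(n, j) w(j) over j. Allowing any `w` instead of one fixed layer
  -- turns Pascal's rule into a shift of `w`, which suits induction on n.
  layers : ∀ n → (ℕ → ℤ) → ℤ
  layers n w = ∑ᶜ {n} (λ A → w ∣ A ∣)

  layers-suc : ∀ n w → layers (suc n) w ≡ layers n w + layers n (shift w)
  layers-suc n w = ∑ᶜ-∷ {n} (λ A → w ∣ A ∣)

  ⟨_,_⟩ : (Fin n → ℤ) → Assignment n → ℤ
  ⟨ y , A ⟩ = sum (λ i → y i * χ (lookup A i))

  ⟨⟩-false∷ : ∀ (y : Fin (suc n) → ℤ) (A : Assignment n) → ⟨ y , false ∷ A ⟩ ≡ ⟨ tail y , A ⟩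
  ⟨⟩-false∷ y A = trans (cong (λ z → z + ⟨ tail y , A ⟩) (ℤ.*-zeroʳ (y zero))) (ℤ.+-identityˡ ⟨ tail y , A ⟩)

  ⟨⟩-true∷ : ∀ (y : Fin (suc n) → ℤ) (A : Assignment n) → ⟨ y , true ∷ A ⟩ ≡ y zero + ⟨ tail y , A ⟩
  ⟨⟩-true∷ y A = cong (λ z → z + ⟨ tail y , A ⟩) (ℤ.*-identityʳ (y zero))

  moment₁ moment₂ : (ℕ → ℤ) → (Fin n → ℤ) → ℤ
  moment₁ w y = ∑ᶜ (λ A → w ∣ A ∣ * ⟨ y , A ⟩)
  moment₂ w y = ∑ᶜ (λ A → w ∣ A ∣ * (⟨ y , A ⟩ * ⟨ y , A ⟩))

  moment₁-∷ : ∀ w (y : Fin (suc n) → ℤ) → moment₁ w y ≡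
    moment₁ w (tail y) + (y zero * layers n (shift w) + moment₁ (shift w) (tail y))
  moment₁-∷ {n} w y = begin
    moment₁ w y
      ≡⟨ ∑ᶜ-∷ (λ A → w ∣ A ∣ * ⟨ y , A ⟩) ⟩
    ∑ᶜ (λ A → w ∣ A ∣ * ⟨ y , false ∷ A ⟩) + ∑ᶜ (λ A → v A * ⟨ y , true ∷ A ⟩)
      ≡⟨ cong₂ _+_ (∑ᶜ-cong (λ A → cong (w ∣ A ∣ *_) (⟨⟩-false∷ y A)))
           (∑ᶜ-cong (λ A → trans (cong (v A *_) (⟨⟩-true∷ y A)) (expand (v A) (y zero) ⟨ tail y , A ⟩))) ⟩
    moment₁ w (tail y) + ∑ᶜ (λ A → y zero * v A + v A * ⟨ tail y , A ⟩)
      ≡⟨ cong (_+_ (moment₁ w (tail y))) (∑ᶜ-+ (λ A → y zero * v A) (λ A → v A * ⟨ tail y , A ⟩)) ⟩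
    moment₁ w (tail y) + (∑ᶜ (λ A → y zero * v A) + moment₁ (shift w) (tail y))
      ≡⟨ cong (λ z → moment₁ w (tail y) + (z + moment₁ (shift w) (tail y))) (∑ᶜ-* (y zero) v) ⟩
    moment₁ w (tail y) + (y zero * layers n (shift w) + moment₁ (shift w) (tail y)) ∎
    where
    open ≡-Reasoning
    v : Assignment n → ℤ
    v A = w (suc ∣ A ∣)
    expand : ∀ v a b → v * (a + b) ≡ a * v + v * b
    expand = solve-∀

  moment₂-∷ : ∀ w (y : Fin (suc n) → ℤ) → moment₂ w y ≡
    moment₂ w (tail y) + (y zero * y zero * layers n (shift w) +
      (+ 2 * y zero * moment₁ (shift w) (tail y) + moment₂ (shift w) (tail y)))
  moment₂-∷ {n} w y = begin
    moment₂ w y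
      ≡⟨ ∑ᶜ-∷ (λ A → w ∣ A ∣ * (⟨ y , A ⟩ * ⟨ y , A ⟩)) ⟩
    ∑ᶜ (λ A → w ∣ A ∣ * (⟨ y , false ∷ A ⟩ * ⟨ y , false ∷ A ⟩)) +
    ∑ᶜ (λ A → v A * (⟨ y , true ∷ A ⟩ * ⟨ y , true ∷ A ⟩))
      ≡⟨ cong₂ _+_ (∑ᶜ-cong (λ A → cong (λ z → w ∣ A ∣ * (z * z)) (⟨⟩-false∷ y A)))
           (∑ᶜ-cong (λ A → trans (cong (λ z → v A * (z * z)) (⟨⟩-true∷ y A)) (expand (v A) y₀ ⟨ tail y , A ⟩))) ⟩
    moment₂ w (tail y) + ∑ᶜ (λ A → y₀ * y₀ * v A +
      (+ 2 * y₀ * (v A * ⟨ tail y , A ⟩) + v A * (⟨ tail y , A ⟩ * ⟨ tail y , A ⟩)))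
      ≡⟨ cong (_+_ (moment₂ w (tail y))) (trans
           (∑ᶜ-+ (λ A → y₀ * y₀ * v A)
             (λ A → + 2 * y₀ * (v A * ⟨ tail y , A ⟩) + v A * (⟨ tail y , A ⟩ * ⟨ tail y , A ⟩)))
           (cong₂ _+_ (∑ᶜ-* (y₀ * y₀) v) (trans
             (∑ᶜ-+ (λ A → + 2 * y₀ * (v A * ⟨ tail y , A ⟩)) (λ A → v A * (⟨ tail y , A ⟩ * ⟨ tail y , A ⟩)))
             (cong (λ z → z + moment₂ (shift w) (tail y)) (∑ᶜ-* (+ 2 * y₀) (λ A → v A * ⟨ tail y , A ⟩)))))) ⟩
    moment₂ w (tail y) + (y₀ * y₀ * layers n (shift w) +
      (+ 2 * y₀ * moment₁ (shift w) (tail y) + moment₂ (shift w) (tail y))) ∎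
    where
    open ≡-Reasoning
    y₀ = y zero
    v : Assignment n → ℤ
    v A = w (suc ∣ A ∣)
    expand : ∀ v a b → v * ((a + b) * (a + b)) ≡ a * a * v + (+ 2 * a * (v * b) + v * (b * b))
    expand = solve-∀

  moment₁-[] : ∀ w (y : Fin 0 → ℤ) → moment₁ w y ≡ 0ℤ
  moment₁-[] w y = trans (∑ᶜ-[] (λ A → w ∣ A ∣ * ⟨ y , A ⟩)) (ℤ.*-zeroʳ (w 0))

  moment₂-[] : ∀ w (y : Fin 0 → ℤ) → moment₂ w y ≡ 0ℤ
  moment₂-[] w y = trans (∑ᶜ-[] (λ A → w ∣ A ∣ * (⟨ y , A ⟩ * ⟨ y , A ⟩))) (ℤ.*-zeroʳ (w 0))

  -- The coefficient of yᵢ is the weight of all assignments with a 1 at i. Deleting that coordinate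
  -- leaves a cube of dimension n with `w` shifted once, whatever i is.
  moment₁-closed : ∀ n w (y : Fin (suc n) → ℤ) → moment₁ w y ≡ sum y * layers n (shift w)
  moment₁-closed zero w y = begin
    moment₁ w y
      ≡⟨ moment₁-∷ w y ⟩
    moment₁ w (tail y) + (y zero * layers 0 (shift w) + moment₁ (shift w) (tail y))
      ≡⟨ cong₂ (λ a b → a + (y zero * layers 0 (shift w) + b))
           (moment₁-[] w (tail y)) (moment₁-[] (shift w) (tail y)) ⟩
    0ℤ + (y zero * layers 0 (shift w) + 0ℤ)
      ≡⟨ base (y zero) (layers 0 (shift w)) ⟩
    sum y * layers 0 (shift w) ∎
    where
    open ≡-Reasoning
    base : ∀ a z → 0ℤ + (a * z + 0ℤ) ≡ (a + 0ℤ) * z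
    base = solve-∀
  moment₁-closed (suc n) w y = begin
    moment₁ w y
      ≡⟨ moment₁-∷ w y ⟩
    moment₁ w (tail y) + (y zero * layers (suc n) (shift w) + moment₁ (shift w) (tail y))
      ≡⟨ cong₂ (λ a b → a + (y zero * layers (suc n) (shift w) + b))
           (moment₁-closed n w (tail y)) (moment₁-closed n (shift w) (tail y)) ⟩
    s * Z₁ + (y zero * layers (suc n) (shift w) + s * Z₂)
      ≡⟨ cong (λ z → s * Z₁ + (y zero * z + s * Z₂)) (layers-suc n (shift w)) ⟩
    s * Z₁ + (y zero * (Z₁ + Z₂) + s * Z₂)
      ≡⟨ step s (y zero) Z₁ Z₂ ⟩
    (y zero + s) * (Z₁ + Z₂)
      ≡⟨ cong (λ z → (y zero + s) * z) (layers-suc n (shift w)) ⟨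
    sum y * layers (suc n) (shift w) ∎
    where
    open ≡-Reasoning
    s = sum (tail y)
    Z₁ = layers n (shift w)
    Z₂ = layers n (shift (shift w))
    step : ∀ s a b c → s * b + (a * (b + c) + s * c) ≡ (a + s) * (b + c)
    step = solve-∀

  moment₂-one : ∀ w (y : Fin 1 → ℤ) → moment₂ w y ≡ y zero * y zero * layers 0 (shift w)
  moment₂-one w y = begin
    moment₂ w y
      ≡⟨ moment₂-∷ w y ⟩
    moment₂ w (tail y) + (y zero * y zero * z +
      (+ 2 * y zero * moment₁ (shift w) (tail y) + moment₂ (shift w) (tail y)))
      ≡⟨ cong₂ (λ a b → a + (y zero * y zero * z + b)) (moment₂-[] w (tail y))
           (cong₂ (λ a b → + 2 * y zero * a + b) (moment₁-[] (shift w) (tail y)) (moment₂-[] (shift w) (tail y))) ⟩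
    0ℤ + (y zero * y zero * z + (+ 2 * y zero * 0ℤ + 0ℤ))
      ≡⟨ base (y zero) z ⟩
    y zero * y zero * layers 0 (shift w) ∎
    where
    open ≡-Reasoning
    z = layers 0 (shift w)
    base : ∀ a z → 0ℤ + (a * a * z + (+ 2 * a * 0ℤ + 0ℤ)) ≡ a * a * z
    base = solve-∀

  -- With Z₁ and Z₂ the layer sums for one and two shifts, yᵢ² has coefficient Z₁ + Z₂ (a 1 at i,
  -- the bit at one other place free) and yᵢyⱼ for i ≠ j has coefficient Z₂ (ones at both).
  -- Completing the square of the sum of y leaves Z₁ on the squares, and the other term disappears
  -- for centred y.
  moment₂-closed : ∀ n w (y : Fin (suc (suc n)) → ℤ) → moment₂ w y ≡
    sum (λ i → y i * y i) * layers n (shift w) + sum y * sum y * layers n (shift (shift w))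
  moment₂-closed zero w y = begin
    moment₂ w y
      ≡⟨ moment₂-∷ w y ⟩
    moment₂ w (tail y) + (a * a * layers 1 (shift w) +
      (+ 2 * a * moment₁ (shift w) (tail y) + moment₂ (shift w) (tail y)))
      ≡⟨ cong₂ _+_ (moment₂-one w (tail y)) (cong₂ (λ l m → a * a * l + m) (layers-suc 0 (shift w))
           (cong₂ (λ l m → + 2 * a * l + m)
             (moment₁-closed 0 (shift w) (tail y)) (moment₂-one (shift w) (tail y)))) ⟩
    b * b * Z₁ + (a * a * (Z₁ + Z₂) + (+ 2 * a * ((b + 0ℤ) * Z₂) + b * b * Z₂))
      ≡⟨ base a b Z₁ Z₂ ⟩
    (a * a + (b * b + 0ℤ)) * Z₁ + (a + (b + 0ℤ)) * (a + (b + 0ℤ)) * Z₂ ∎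
    where
    open ≡-Reasoning
    a = y zero
    b = y (suc zero)
    Z₁ = layers 0 (shift w)
    Z₂ = layers 0 (shift (shift w))
    base : ∀ a b w₁ w₂ →
      b * b * w₁ + (a * a * (w₁ + w₂) + (+ 2 * a * ((b + 0ℤ) * w₂) + b * b * w₂))
      ≡ (a * a + (b * b + 0ℤ)) * w₁ + (a + (b + 0ℤ)) * (a + (b + 0ℤ)) * w₂
    base = solve-∀
  moment₂-closed (suc n) w y = begin
    moment₂ w y
      ≡⟨ moment₂-∷ w y ⟩
    moment₂ w (tail y) + (a * a * layers (2 ℕ.+ n) (shift w) +
      (+ 2 * a * moment₁ (shift w) (tail y) + moment₂ (shift w) (tail y)))
      ≡⟨ cong₂ _+_ (moment₂-closed n w (tail y))
           (cong₂ (λ l m → a * a * l + m) layers-suc²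
             (cong₂ (λ l m → + 2 * a * l + m)
               (trans (moment₁-closed (suc n) (shift w) (tail y))
                 (cong (λ z → s * z) (layers-suc n (shift (shift w)))))
               (moment₂-closed n (shift w) (tail y)))) ⟩
    q * Z₁ + s * s * Z₂ + (a * a * (Z₁ + Z₂ + (Z₂ + Z₃)) +
      (+ 2 * a * (s * (Z₂ + Z₃)) + (q * Z₂ + s * s * Z₃)))
      ≡⟨ step q s a Z₁ Z₂ Z₃ ⟩
    (a * a + q) * (Z₁ + Z₂) + (a + s) * (a + s) * (Z₂ + Z₃)
      ≡⟨ cong₂ (λ l m → (a * a + q) * l + (a + s) * (a + s) * m)
           (layers-suc n (shift w)) (layers-suc n (shift (shift w))) ⟨
    sum (λ i → y i * y i) * layers (suc n) (shift w) + sum y * sum y * layers (suc n) (shift (shift w)) ∎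
    where
    open ≡-Reasoning
    a = y zero
    s = sum (tail y)
    q = sum (λ i → tail y i * tail y i)
    Z₁ = layers n (shift w)
    Z₂ = layers n (shift (shift w))
    Z₃ = layers n (shift (shift (shift w)))
    layers-suc² : layers (2 ℕ.+ n) (shift w) ≡ Z₁ + Z₂ + (Z₂ + Z₃)
    layers-suc² = trans (layers-suc (suc n) (shift w))
      (cong₂ _+_ (layers-suc n (shift w)) (layers-suc n (shift (shift w))))
    step : ∀ q s a z₁ z₂ z₃ →
      q * z₁ + s * s * z₂ + (a * a * (z₁ + z₂ + (z₂ + z₃)) +
        (+ 2 * a * (s * (z₂ + z₃)) + (q * z₂ + s * s * z₃)))
      ≡ (a * a + q) * (z₁ + z₂) + (a + s) * (a + s) * (z₂ + z₃)
    step = solve-∀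

  -- Double counting of edges.

  ∑ᶜ-flip : ∀ (i : Fin n) (H : Assignment n → ℤ) →
    ∑ᶜ (λ A → χ (lookup A i) * H (A [ i ]≔ false)) ≡ ∑ᶜ (λ B → (1ℤ - χ (lookup B i)) * H B)
  ∑ᶜ-flip zero H = begin
    ∑ᶜ (λ A → χ (lookup A zero) * H (A [ zero ]≔ false))
      ≡⟨ ∑ᶜ-∷ (λ A → χ (lookup A zero) * H (A [ zero ]≔ false)) ⟩
    ∑ᶜ (λ A → 0ℤ * H (false ∷ A)) + ∑ᶜ (λ A → 1ℤ * H (false ∷ A))
      ≡⟨ ℤ.+-comm (∑ᶜ (λ A → 0ℤ * H (false ∷ A))) (∑ᶜ (λ A → 1ℤ * H (false ∷ A))) ⟩
    ∑ᶜ (λ A → 1ℤ * H (false ∷ A)) + ∑ᶜ (λ A → 0ℤ * H (false ∷ A))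
      ≡⟨ cong (_+_ (∑ᶜ (λ A → 1ℤ * H (false ∷ A))))
           (∑ᶜ-cong (λ A → trans (ℤ.*-zeroˡ (H (false ∷ A))) (sym (ℤ.*-zeroˡ (H (true ∷ A)))))) ⟩
    ∑ᶜ (λ A → 1ℤ * H (false ∷ A)) + ∑ᶜ (λ A → 0ℤ * H (true ∷ A))
      ≡⟨ ∑ᶜ-∷ (λ B → (1ℤ - χ (lookup B zero)) * H B) ⟨
    ∑ᶜ (λ B → (1ℤ - χ (lookup B zero)) * H B) ∎
    where open ≡-Reasoning
  ∑ᶜ-flip (suc i) H = begin
    ∑ᶜ (λ A → χ (lookup A (suc i)) * H (A [ suc i ]≔ false))
      ≡⟨ ∑ᶜ-∷ (λ A → χ (lookup A (suc i)) * H (A [ suc i ]≔ false)) ⟩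
    ∑ᶜ (λ A → χ (lookup A i) * H (false ∷ (A [ i ]≔ false))) +
    ∑ᶜ (λ A → χ (lookup A i) * H (true ∷ (A [ i ]≔ false)))
      ≡⟨ cong₂ _+_ (∑ᶜ-flip i (λ A → H (false ∷ A))) (∑ᶜ-flip i (λ A → H (true ∷ A))) ⟩
    ∑ᶜ (λ B → (1ℤ - χ (lookup B i)) * H (false ∷ B)) + ∑ᶜ (λ B → (1ℤ - χ (lookup B i)) * H (true ∷ B))
      ≡⟨ ∑ᶜ-∷ (λ B → (1ℤ - χ (lookup B (suc i))) * H B) ⟨
    ∑ᶜ (λ B → (1ℤ - χ (lookup B (suc i))) * H B) ∎
    where open ≡-Reasoning

  ∣∣-flip : ∀ (A : Assignment n) i → lookup A i ≡ true → ∣ A ∣ ≡ suc ∣ A [ i ]≔ false ∣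
  ∣∣-flip (true ∷ A)  zero    refl = refl
  ∣∣-flip (false ∷ A) (suc i) eq   = ∣∣-flip A i eq
  ∣∣-flip (true ∷ A)  (suc i) eq   = cong suc (∣∣-flip A i eq)

  χ-shift : ∀ w (A : Assignment n) i →
    χ (lookup A i) * w ∣ A ∣ ≡ χ (lookup A i) * shift w ∣ A [ i ]≔ false ∣
  χ-shift w A i with lookup A i in eq
  ... | true  = cong (λ j → 1ℤ * w j) (∣∣-flip A i eq)
  ... | false = refl

  -- The w-weighted number of edges (A , A \ i) in direction i along which φ
  -- changes, counted with sign.
  edges : (ℕ → ℤ) → (Assignment n → ℤ) → Fin n → ℤ
  edges w φ i = ∑ᶜ (λ A → w ∣ A ∣ * (χ (lookup A i) * (φ A - φ (A [ i ]≔ false))))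

  -- Each edge is charged to its upper end A and its lower end B. Clearing bit i is a bijection from
  -- the assignments with a 1 at i onto those with a 0 there, so by `∑ᶜ-flip` the second charge
  -- becomes a sum over B, whose weight is one less.
  edges-split : ∀ w (φ : Assignment n → ℤ) i → edges w φ i ≡
    ∑ᶜ (λ A → w ∣ A ∣ * φ A * χ (lookup A i)) - ∑ᶜ (λ B → shift w ∣ B ∣ * φ B * (1ℤ - χ (lookup B i)))
  edges-split w φ i = begin
    edges w φ i
      ≡⟨ ∑ᶜ-cong split ⟩
    ∑ᶜ (λ A → upper A - χ (lookup A i) * H (A [ i ]≔ false))
      ≡⟨ ∑ᶜ-- upper (λ A → χ (lookup A i) * H (A [ i ]≔ false)) ⟩
    ∑ᶜ upper - ∑ᶜ (λ A → χ (lookup A i) * H (A [ i ]≔ false))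
      ≡⟨ cong (λ z → ∑ᶜ upper - z) (trans (∑ᶜ-flip i H) (∑ᶜ-cong (λ B → ℤ.*-comm (1ℤ - χ (lookup B i)) (H B)))) ⟩
    ∑ᶜ upper - ∑ᶜ (λ B → H B * (1ℤ - χ (lookup B i))) ∎
    where
    open ≡-Reasoning
    upper H : Assignment _ → ℤ
    upper A = w ∣ A ∣ * φ A * χ (lookup A i)
    H B = shift w ∣ B ∣ * φ B
    distribute : ∀ v c a b → v * (c * (a - b)) ≡ v * a * c - c * v * b
    distribute = solve-∀
    split : ∀ A → w ∣ A ∣ * (χ (lookup A i) * (φ A - φ (A [ i ]≔ false))) ≡
      upper A - χ (lookup A i) * H (A [ i ]≔ false)
    split A = begin
      w ∣ A ∣ * (x * (φ A - φ A′))           ≡⟨ distribute (w ∣ A ∣) x (φ A) (φ A′) ⟩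
      upper A - x * w ∣ A ∣ * φ A′           ≡⟨ cong (λ z → upper A - z * φ A′) (χ-shift w A i) ⟩
      upper A - x * shift w ∣ A′ ∣ * φ A′    ≡⟨ cong (λ z → upper A - z) (ℤ.*-assoc x (shift w ∣ A′ ∣) (φ A′)) ⟩
      upper A - x * H A′                     ∎
      where
      x = χ (lookup A i)
      A′ = A [ i ]≔ false

  ∑ᶜ-linear : ∀ {m} (f : Assignment n → ℤ) (y : Fin m → ℤ) (g : Fin m → Assignment n → ℤ) →
    ∑ᶜ (λ A → f A * sum (λ i → y i * g i A)) ≡ sum (λ i → y i * ∑ᶜ (λ A → f A * g i A))
  ∑ᶜ-linear f y g = begin
    ∑ᶜ (λ A → f A * sum (λ i → y i * g i A))
      ≡⟨ ∑ᶜ-cong (λ A → *-distribˡ-sum (f A) (λ i → y i * g i A)) ⟩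
    ∑ᶜ (λ A → sum (λ i → f A * (y i * g i A)))
      ≡⟨ ∑ᶜ-sum (λ i A → f A * (y i * g i A)) ⟩
    sum (λ i → ∑ᶜ (λ A → f A * (y i * g i A)))
      ≡⟨ sum-cong-≗ (λ i → trans (∑ᶜ-cong (λ A → rearrange (f A) (y i) (g i A))) (∑ᶜ-* (y i) (λ A → f A * g i A))) ⟩
    sum (λ i → y i * ∑ᶜ (λ A → f A * g i A)) ∎
    where
    open ≡-Reasoning
    rearrange : ∀ a b c → a * (b * c) ≡ b * (a * c)
    rearrange = solve-∀

  sum-- : ∀ {m} (f g : Fin m → ℤ) → sum (λ i → f i - g i) ≡ sum f - sum g
  sum-- {zero}  f g = refl
  sum-- {suc m} f g = trans (cong (_+_ (f zero - g zero)) (sum-- (tail f) (tail g)))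
    (interchange (f zero) (g zero) (sum (tail f)) (sum (tail g)))
    where
    interchange : ∀ a b c d → a - b + (c - d) ≡ a + c - (b + d)
    interchange = solve-∀

  sum-1-χ : ∀ (y : Fin n → ℤ) A → sum (λ i → y i * (1ℤ - χ (lookup A i))) ≡ sum y - ⟨ y , A ⟩
  sum-1-χ y A = trans (sum-cong-≗ (λ i → distribute (y i) (χ (lookup A i)))) (sum-- y (λ i → y i * χ (lookup A i)))
    where
    distribute : ∀ a b → a * (1ℤ - b) ≡ a - a * b
    distribute = solve-∀

  -- Summing over directions, an upper end collects the y-weight of its ones and a lower end that of
  -- its zeros. It is used twice: with centred y for the upper bound on edges, and with y = 1, where
  -- the collected weights are degrees, for the lower bound.
  edges-weighted : ∀ w (φ : Assignment n → ℤ) y → sum (λ i → y i * edges w φ i) ≡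
    ∑ᶜ (λ A → w ∣ A ∣ * φ A * ⟨ y , A ⟩) - ∑ᶜ (λ B → shift w ∣ B ∣ * φ B * (sum y - ⟨ y , B ⟩))
  edges-weighted w φ y = begin
    sum (λ i → y i * edges w φ i)
      ≡⟨ sum-cong-≗ (λ i → trans (cong (y i *_) (edges-split w φ i)) (distribute (y i) (P i) (Q i))) ⟩
    sum (λ i → y i * P i - y i * Q i)
      ≡⟨ sum-- (λ i → y i * P i) (λ i → y i * Q i) ⟩
    sum (λ i → y i * P i) - sum (λ i → y i * Q i)
      ≡⟨ cong₂ _-_ (∑ᶜ-linear (λ A → w ∣ A ∣ * φ A) y (λ i A → χ (lookup A i)))
           (∑ᶜ-linear (λ B → shift w ∣ B ∣ * φ B) y (λ i B → 1ℤ - χ (lookup B i))) ⟨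
    ∑ᶜ (λ A → w ∣ A ∣ * φ A * ⟨ y , A ⟩) -
    ∑ᶜ (λ B → shift w ∣ B ∣ * φ B * sum (λ i → y i * (1ℤ - χ (lookup B i))))
      ≡⟨ cong (λ z → ∑ᶜ (λ A → w ∣ A ∣ * φ A * ⟨ y , A ⟩) - z)
           (∑ᶜ-cong (λ B → cong (shift w ∣ B ∣ * φ B *_) (sum-1-χ y B))) ⟩
    ∑ᶜ (λ A → w ∣ A ∣ * φ A * ⟨ y , A ⟩) - ∑ᶜ (λ B → shift w ∣ B ∣ * φ B * (sum y - ⟨ y , B ⟩)) ∎
    where
    open ≡-Reasoning
    P Q : Fin _ → ℤ
    P i = ∑ᶜ (λ A → w ∣ A ∣ * φ A * χ (lookup A i))
    Q i = ∑ᶜ (λ B → shift w ∣ B ∣ * φ B * (1ℤ - χ (lookup B i)))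
    distribute : ∀ a b c → a * (b - c) ≡ a * b - a * c
    distribute = solve-∀

  -- When y sums to zero, the y-weight of the zeros of B is -⟨y,B⟩, so the difference over the two
  -- layers becomes a sum of two terms of the same shape.
  edges-centred : ∀ w (φ : Assignment n → ℤ) y → sum y ≡ 0ℤ → sum (λ i → y i * edges w φ i) ≡
    ∑ᶜ (λ A → w ∣ A ∣ * φ A * ⟨ y , A ⟩) + ∑ᶜ (λ B → shift w ∣ B ∣ * φ B * ⟨ y , B ⟩)
  edges-centred w φ y Σy≡0 = begin
    sum (λ i → y i * edges w φ i)
      ≡⟨ edges-weighted w φ y ⟩
    P - ∑ᶜ (λ B → Q B * (sum y - ⟨ y , B ⟩))
      ≡⟨ cong (λ z → P - z) (∑ᶜ-cong (λ B → trans (cong (λ z → Q B * (z - ⟨ y , B ⟩)) Σy≡0) (neg (Q B) ⟨ y , B ⟩))) ⟩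
    P - ∑ᶜ (λ B → - 1ℤ * (Q B * ⟨ y , B ⟩))
      ≡⟨ cong (λ z → P - z) (∑ᶜ-* (- 1ℤ) (λ B → Q B * ⟨ y , B ⟩)) ⟩
    P - - 1ℤ * ∑ᶜ (λ B → Q B * ⟨ y , B ⟩)
      ≡⟨ neg² P (∑ᶜ (λ B → Q B * ⟨ y , B ⟩)) ⟩
    P + ∑ᶜ (λ B → Q B * ⟨ y , B ⟩) ∎
    where
    open ≡-Reasoning
    P = ∑ᶜ (λ A → w ∣ A ∣ * φ A * ⟨ y , A ⟩)
    Q : Assignment _ → ℤ
    Q B = shift w ∣ B ∣ * φ B
    neg : ∀ a b → a * (0ℤ - b) ≡ - 1ℤ * (a * b)
    neg = solve-∀
    neg² : ∀ a b → a - - 1ℤ * b ≡ a + b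
    neg² = solve-∀

  -- From first moments to second moments.

  amgm : ∀ μ ν b Y → + 2 * μ * ν * (χ b * Y) ≤ μ * μ + ν * ν * (Y * Y)
  amgm μ ν true Y = certify-≤ (square μ ν Y) (square-nonNeg (μ - ν * Y))
    where
    square : ∀ μ ν Y → μ * μ + ν * ν * (Y * Y) ≡ + 2 * μ * ν * (1ℤ * Y) + (μ - ν * Y) * (μ - ν * Y)
    square = solve-∀
  amgm μ ν false Y = certify-≤ (zeroed μ ν Y) (ℤ.+-mono-≤ (square-nonNeg μ) (square-nonNeg (ν * Y)))
    where
    zeroed : ∀ μ ν Y → μ * μ + ν * ν * (Y * Y) ≡ + 2 * μ * ν * (0ℤ * Y) + (μ * μ + ν * Y * (ν * Y))
    zeroed = solve-∀

  -- The bound in `amgm` is the same whether φ accepts or rejects, so the right side involves the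
  -- whole layer, whose second moment is known exactly.
  layer-amgm : ∀ w → (∀ j → 0ℤ ≤ w j) → ∀ (φ : Assignment n → Bool) y μ ν →
    + 2 * μ * ν * ∑ᶜ (λ A → w ∣ A ∣ * χ (φ A) * ⟨ y , A ⟩) ≤ μ * μ * layers n w + ν * ν * moment₂ w y
  layer-amgm {n} w 0≤w φ y μ ν = subst₂ _≤_
    (∑ᶜ-* (+ 2 * μ * ν) (λ A → w ∣ A ∣ * χ (φ A) * ⟨ y , A ⟩))
    (trans (∑ᶜ-+ (λ A → μ * μ * w ∣ A ∣) (λ A → ν * ν * (w ∣ A ∣ * (⟨ y , A ⟩ * ⟨ y , A ⟩))))
      (cong₂ _+_ (∑ᶜ-* {n} (μ * μ) (λ A → w ∣ A ∣)) (∑ᶜ-* (ν * ν) (λ A → w ∣ A ∣ * (⟨ y , A ⟩ * ⟨ y , A ⟩)))))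
    (∑ᶜ-mono (λ A → subst₂ _≤_
      (regroupˡ (w ∣ A ∣) (+ 2 * μ * ν) (χ (φ A)) ⟨ y , A ⟩)
      (regroupʳ (w ∣ A ∣) (μ * μ) (ν * ν) (⟨ y , A ⟩ * ⟨ y , A ⟩))
      (ℤ.*-monoˡ-≤-nonNeg (w ∣ A ∣) {{nonNegative (0≤w ∣ A ∣)}} (amgm μ ν (φ A) ⟨ y , A ⟩))))
    where
    regroupˡ : ∀ w c b Y → w * (c * (b * Y)) ≡ c * (w * b * Y)
    regroupˡ = solve-∀
    regroupʳ : ∀ w a c d → w * (a + c * d) ≡ a * w + c * (w * d)
    regroupʳ = solve-∀

  layers-nonNeg : ∀ n w → (∀ j → 0ℤ ≤ w j) → 0ℤ ≤ layers n w
  layers-nonNeg n w 0≤w = ∑ᶜ-nonNeg {n} (λ A → 0≤w ∣ A ∣)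

  -- Pascal's rule twice: the middle term of the expansion of layers (2 + n) w is doubled.
  layers-mid : ∀ n w → (∀ j → 0ℤ ≤ w j) → + 2 * layers n (shift w) ≤ layers (2 ℕ.+ n) w
  layers-mid n w 0≤w = certify-≤
    (trans (trans (layers-suc (suc n) w) (cong₂ _+_ (layers-suc n w) (layers-suc n (shift w))))
      (collect (layers n w) (layers n (shift w)) (layers n (shift (shift w)))))
    (ℤ.+-mono-≤ (layers-nonNeg n w 0≤w) (layers-nonNeg n (shift (shift w)) (λ j → 0≤w (2 ℕ.+ j))))
    where
    collect : ∀ a b c → a + b + (b + c) ≡ + 2 * b + (a + c)
    collect = solve-∀

  -- Edges along which a function of few variables changes.

  ∑χ : (Fin n → Bool) → ℤ
  ∑χ s = sum (λ i → χ (s i))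

  module _ (s : Fin n → Bool) where
    private
      r = ∑χ s

    centred : Fin n → ℤ
    centred i = + n * χ (s i) - r

    centred-sum : sum centred ≡ 0ℤ
    centred-sum = begin
      sum centred
        ≡⟨ sum-- (λ i → + n * χ (s i)) (λ _ → r) ⟩
      sum (λ i → + n * χ (s i)) - sum {n} (λ _ → r)
        ≡⟨ cong₂ _-_ (sym (*-distribˡ-sum (+ n) (λ i → χ (s i)))) (sum-const n r) ⟩
      + n * r - + n * r
        ≡⟨ ℤ.+-inverseʳ (+ n * r) ⟩
      0ℤ ∎
      where open ≡-Reasoning

    -- There are r entries equal to n - r and n - r entries equal to -r, and r(n - r)² + (n - r)r² =
    -- nr(n - r).
    centred-squares : sum (λ i → centred i * centred i) ≡ + n * r * (+ n - r)
    centred-squares = begin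
      sum (λ i → centred i * centred i)
        ≡⟨ sum-cong-≗ (λ i → square (s i)) ⟩
      sum (λ i → c * χ (s i) + r * r)
        ≡⟨ ∑-distrib-+ (λ i → c * χ (s i)) (λ _ → r * r) ⟩
      sum (λ i → c * χ (s i)) + sum {n} (λ _ → r * r)
        ≡⟨ cong₂ _+_ (sym (*-distribˡ-sum c (λ i → χ (s i)))) (sum-const n (r * r)) ⟩
      c * r + + n * (r * r)
        ≡⟨ collect (+ n) r ⟩
      + n * r * (+ n - r) ∎
      where
      open ≡-Reasoning
      c = + n * + n - + 2 * + n * r
      collect : ∀ n r → (n * n - + 2 * n * r) * r + n * (r * r) ≡ n * r * (n - r)
      collect = solve-∀
      -- The coefficient `c` relies on χ² = χ, which is not a ring identity; hence the values 1 and
      -- 0 are expanded separately.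
      on : ∀ n r → (n * 1ℤ - r) * (n * 1ℤ - r) ≡ (n * n - + 2 * n * r) * 1ℤ + r * r
      on = solve-∀
      off : ∀ n r → (n * 0ℤ - r) * (n * 0ℤ - r) ≡ (n * n - + 2 * n * r) * 0ℤ + r * r
      off = solve-∀
      square : ∀ b → (+ n * χ b - r) * (+ n * χ b - r) ≡ c * χ b + r * r
      square true  = on (+ n) r
      square false = off (+ n) r

    -- Clearing bits is enough: at an assignment with a 1 at i, the equation compares both ends of
    -- the edge in direction i.
    DependsOnlyOn : (Assignment n → Bool) → Set
    DependsOnlyOn φ = ∀ i → s i ≡ false → ∀ A → φ (A [ i ]≔ false) ≡ φ A

    -- Directions outside S carry no sensitive edge, and on S the weight yᵢ has the constant value n
    -- - r, which factors out.
    centred-edges : ∀ w φ → DependsOnlyOn φ →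
      sum (λ i → centred i * edges w (χ ∘ φ) i) ≡ (+ n - r) * sum (edges w (χ ∘ φ))
    centred-edges w φ junta = trans (sum-cong-≗ pointwise) (sym (*-distribˡ-sum (+ n - r) (edges w (χ ∘ φ))))
      where
      insensitive : ∀ i → s i ≡ false → edges w (χ ∘ φ) i ≡ 0ℤ
      insensitive i si≡f = trans
        (∑ᶜ-cong (λ A → trans (cong (λ b → w ∣ A ∣ * (χ (lookup A i) * (χ (φ A) - χ b))) (junta i si≡f A))
          (vanish (w ∣ A ∣) (χ (lookup A i)) (χ (φ A)))))
        (∑ᶜ-zero n)
        where
        vanish : ∀ a b c → a * (b * (c - c)) ≡ 0ℤ
        vanish = solve-∀
      pointwise : ∀ i → centred i * edges w (χ ∘ φ) i ≡ (+ n - r) * edges w (χ ∘ φ) i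
      pointwise i with s i in eq
      ... | true  = cong (λ z → (z - r) * edges w (χ ∘ φ) i) (ℤ.*-identityʳ (+ n))
      ... | false = trans (vanish (+ n * 0ℤ - r)) (sym (vanish (+ n - r)))
        where
        vanish : ∀ a → a * edges w (χ ∘ φ) i ≡ 0ℤ
        vanish a = trans (cong (λ z → a * z) (insensitive i eq)) (ℤ.*-zeroʳ a)

  module _ (m : ℕ) (w : ℕ → ℤ) (0≤w : ∀ j → 0ℤ ≤ w j)
           (φ : Assignment (2 ℕ.+ m) → Bool) (s : Fin (2 ℕ.+ m) → Bool) (junta : DependsOnlyOn s φ)
           (k : ℤ) (r≤k : ∑χ s ≤ k) (2k≤n : + 2 * k ≤ + (2 ℕ.+ m)) where
    private
      n′ = 2 ℕ.+ m
      n″ = + n′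
      r = ∑χ s
      d = n″ - r
      T = sum (edges w (χ ∘ φ))
      N = layers n′ w + layers n′ (shift w)
      Z = layers m (shift w) + layers m (shift (shift w))

      centred-moment : ∀ w → moment₂ w (centred s) ≡ n″ * r * d * layers m (shift w)
      centred-moment w = begin
        moment₂ w (centred s)
          ≡⟨ moment₂-closed m w (centred s) ⟩
        sum (λ i → centred s i * centred s i) * layers m (shift w) +
          sum (centred s) * sum (centred s) * layers m (shift (shift w))
          ≡⟨ cong₂ (λ a b → a * layers m (shift w) + b * b * layers m (shift (shift w)))
               (centred-squares s) (centred-sum s) ⟩
        n″ * r * d * layers m (shift w) + 0ℤ * 0ℤ * layers m (shift (shift w))
          ≡⟨ drop (n″ * r * d * layers m (shift w)) (layers m (shift (shift w))) ⟩
        n″ * r * d * layers m (shift w) ∎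
        where
        open ≡-Reasoning
        drop : ∀ a b → a + 0ℤ * 0ℤ * b ≡ a
        drop = solve-∀

      -- Adds the bounds for the upper layer, weighted by `w`, and the lower layer, weighted by
      -- `shift w`. By `edges-centred` and `centred-edges` the two first moments add up to `d * T`.
      total-amgm : ∀ μ ν → + 2 * μ * ν * (d * T) ≤ μ * μ * N + ν * ν * (n″ * r * d * Z)
      total-amgm μ ν = subst₂ _≤_
        (trans (sym (ℤ.*-distribˡ-+ (+ 2 * μ * ν) S₁ S₂))
          (cong (λ z → + 2 * μ * ν * z)
            (trans (sym (edges-centred w (χ ∘ φ) (centred s) (centred-sum s))) (centred-edges s w φ junta))))
        (trans (cong₂ (λ a b → μ * μ * layers n′ w + ν * ν * a + (μ * μ * layers n′ (shift w) + ν * ν * b))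
            (centred-moment w) (centred-moment (shift w)))
          (collect (μ * μ) (ν * ν) (layers n′ w) (layers n′ (shift w)) (n″ * r * d)
            (layers m (shift w)) (layers m (shift (shift w)))))
        (ℤ.+-mono-≤ (layer-amgm w 0≤w φ (centred s) μ ν)
          (layer-amgm (shift w) (λ j → 0≤w (suc j)) φ (centred s) μ ν))
        where
        S₁ = ∑ᶜ (λ A → w ∣ A ∣ * χ (φ A) * ⟨ centred s , A ⟩)
        S₂ = ∑ᶜ (λ B → shift w ∣ B ∣ * χ (φ B) * ⟨ centred s , B ⟩)
        collect : ∀ a b N₁ N₂ q Z₁ Z₂ →
          a * N₁ + b * (q * Z₁) + (a * N₂ + b * (q * Z₂)) ≡ a * (N₁ + N₂) + b * (q * (Z₁ + Z₂))
        collect = solve-∀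

      0≤N : 0ℤ ≤ N
      0≤N = ℤ.+-mono-≤ (layers-nonNeg n′ w 0≤w) (layers-nonNeg n′ (shift w) (λ j → 0≤w (suc j)))

      -- Over both layers, `Z` is the weight of the assignments with values 1, 0 at two fixed
      -- coordinates, and those with 0, 1 there weigh the same. This is the factor 1/2 in the mean
      -- of ⟨y,·⟩².
      2Z≤N : + 2 * Z ≤ N
      2Z≤N = subst (λ z → z ≤ N) (sym (ℤ.*-distribˡ-+ (+ 2) (layers m (shift w)) (layers m (shift (shift w)))))
        (ℤ.+-mono-≤ (layers-mid m w 0≤w) (layers-mid m (shift w) (λ j → 0≤w (suc j))))

      0≤r : 0ℤ ≤ r
      0≤r = sum-nonNeg {f = λ i → χ (s i)} (λ _ → +≤+ z≤n)

      0≤k : 0ℤ ≤ k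
      0≤k = ℤ.≤-trans 0≤r r≤k

      n≤2d : n″ ≤ + 2 * d
      n≤2d = certify-≤ (split n″ r k) (ℤ.+-mono-≤ (ℤ.i≤j⇒0≤j-i 2k≤n) (*-nonNeg {+ 2} (+≤+ z≤n) (ℤ.i≤j⇒0≤j-i r≤k)))
        where
        split : ∀ n r k → + 2 * (n - r) ≡ n + ((n - + 2 * k) + + 2 * (k - r))
        split = solve-∀

      0≤d : 0ℤ ≤ d
      0≤d = ℤ.*-cancelˡ-≤-pos 0ℤ d (+ 2) (ℤ.≤-trans (+≤+ z≤n) n≤2d)

    -- With μ = n² and ν = 20k, the right side of `total-amgm` is n⁴N + 400k²nrdZ. The first term is
    -- at most 2dn · n²N because n ≤ 2d, the second at most 2dn · 100k³N because r ≤ k and 2Z ≤ N.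
    -- Cancelling 2d and n leaves the bound.
    influence-bound : + 20 * n″ * k * T ≤ (n″ * n″ + + 100 * (k * k * k)) * N
    influence-bound =
      ℤ.*-cancelˡ-≤-pos _ _ n″
        (ℤ.*-cancelˡ-≤-pos _ _ (+ 2 * d) {{positive (ℤ.<-≤-trans (+<+ (s≤s z≤n)) n≤2d)}}
          (subst (λ z → z ≤ + 2 * d * (n″ * ((n″ * n″ + + 100 * (k * k * k)) * N))) (lhs n″ k d T)
            (ℤ.≤-trans (total-amgm (n″ * n″) (+ 20 * k)) (certify-≤ (rhs n″ k r d N Z) slack))))
      where
      lhs : ∀ n k d T → + 2 * (n * n) * (+ 20 * k) * (d * T) ≡ + 2 * d * (n * (+ 20 * n * k * T))
      lhs = solve-∀
      rhs : ∀ n k r d N Z → + 2 * d * (n * ((n * n + + 100 * (k * k * k)) * N)) ≡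
        (n * n * (n * n) * N + + 20 * k * (+ 20 * k) * (n * r * d * Z)) +
        (n * n * n * (N * (+ 2 * d - n)) + + 200 * (k * k) * (n * (d * (r * (N - + 2 * Z) + N * (k - r)))))
      rhs = solve-∀
      0≤n : 0ℤ ≤ n″
      0≤n = +≤+ z≤n
      -- What the estimates gave away: multiples of 2d - n, N - 2Z and k - r.
      slack : 0ℤ ≤ n″ * n″ * n″ * (N * (+ 2 * d - n″)) +
        + 200 * (k * k) * (n″ * (d * (r * (N - + 2 * Z) + N * (k - r))))
      slack = ℤ.+-mono-≤
        (*-nonNeg (*-nonNeg (*-nonNeg 0≤n 0≤n) 0≤n) (*-nonNeg 0≤N (ℤ.i≤j⇒0≤j-i n≤2d)))
        (*-nonNeg (*-nonNeg {+ 200} (+≤+ z≤n) (square-nonNeg k)) (*-nonNeg 0≤n (*-nonNeg 0≤d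
          (ℤ.+-mono-≤ (*-nonNeg 0≤r (ℤ.i≤j⇒0≤j-i 2Z≤N)) (*-nonNeg 0≤N (ℤ.i≤j⇒0≤j-i r≤k))))))

  -- Threshold gates: monotonicity, support, and the union bound over a circuit.

  Σℕ-mono : {f g : Fin n → ℕ} → (∀ i → f i ℕ.≤ g i) → Σℕ f ℕ.≤ Σℕ g
  Σℕ-mono {zero}  f≤g = z≤n
  Σℕ-mono {suc n} f≤g = ℕ.+-mono-≤ (f≤g zero) (Σℕ-mono (f≤g ∘ suc))

  sum-pos : (f : Fin n → ℕ) → sum (λ i → + f i) ≡ + Σℕ f
  sum-pos {zero}  f = refl
  sum-pos {suc n} f = cong (_+_ (+ f zero)) (sum-pos (tail f))

  ≤-sum : {f : Fin n → ℤ} → (∀ i → 0ℤ ≤ f i) → ∀ i → f i ≤ sum f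
  ≤-sum {f = f} 0≤f zero = subst (λ z → z ≤ sum f) (ℤ.+-identityʳ (f zero))
    (ℤ.+-monoʳ-≤ (f zero) (sum-nonNeg (λ i → 0≤f (suc i))))
  ≤-sum {f = f} 0≤f (suc i) = subst (λ z → z ≤ sum f) (ℤ.+-identityˡ (f (suc i)))
    (ℤ.+-mono-≤ (0≤f zero) (≤-sum (λ i → 0≤f (suc i)) i))

  arity≤k : (g : Gate k I) → Gate.arity g ℕ.≤ k
  arity≤k g = ℕ.≤-trans
    (subst (ℕ._≤ Σℕ weight) (ones arity) (Σℕ-mono {f = λ _ → 1} weight>0)) weight≤k
    where
    open Gate g
    ones : ∀ n → Σℕ {n} (λ _ → 1) ≡ n
    ones zero    = refl
    ones (suc n) = cong suc (ones n)

  evalGate-cong : (u v : I → Bool) (g : Gate k I) → (∀ j → u (Gate.input g j) ≡ v (Gate.input g j)) →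
    evalGate u g ≡ evalGate v g
  evalGate-cong u v g u≗v = cong (λ z → ⌊ threshold ℤ.≤? + z ⌋)
    (Σℕ.sum-cong-≗ (λ j → cong (λ b → weight j ℕ.* bit b) (u≗v j)))
    where open Gate g

  evalGate-mono : {u v : I → Bool} (g : Gate k I) → (∀ x → bit (u x) ℕ.≤ bit (v x)) →
    bit (evalGate u g) ℕ.≤ bit (evalGate v g)
  evalGate-mono {u = u} {v} g u≤v
    with threshold ℤ.≤? + Σℕ (λ j → weight j ℕ.* bit (u (input j)))
       | threshold ℤ.≤? + Σℕ (λ j → weight j ℕ.* bit (v (input j)))
    where open Gate g
  ... | no _   | _     = z≤n
  ... | yes _  | yes _ = ℕ.≤-refl
  ... | yes t≤ | no t≰ = contradiction
    (ℤ.≤-trans t≤ (+≤+ (Σℕ-mono (λ j → ℕ.*-monoʳ-≤ (weight j) (u≤v (input j)))))) t≰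
    where open Gate g

  flip-≤ : ∀ (A : Assignment n) i j → bit (lookup (A [ i ]≔ false) j) ℕ.≤ bit (lookup A j)
  flip-≤ A i j with j ≟ i
  ... | yes refl rewrite lookup∘update i A false = z≤n
  ... | no j≢i   rewrite lookup∘update′ j≢i A false = ℕ.≤-refl

  support : Gate k (Fin n) → Fin n → Bool
  support g i = does (any? (λ j → Gate.input g j ≟ i))

  support-depends : (g : Gate k (Fin n)) → DependsOnlyOn (support g) (λ A → evalGate (lookup A) g)
  support-depends g i ∉S A = evalGate-cong (lookup (A [ i ]≔ false)) (lookup A) g
    (λ j → lookup∘update′ (avoids j) A false)
    where
    avoids : ∀ j → Gate.input g j ≢ i
    avoids j eq with any? (λ j → Gate.input g j ≟ i)
    ... | no ∄j = ∄j (j , eq)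

  Σ-≟ : (p : Fin n) → Σℕ (λ i → bit (does (p ≟ i))) ≡ 1
  Σ-≟ {suc n} zero    = cong suc (Σℕ.sum-replicate-zero n)
  Σ-≟ {suc n} (suc p) = Σ-≟ p

  ≤-Σℕ : (f : Fin n → ℕ) → ∀ i → f i ℕ.≤ Σℕ f
  ≤-Σℕ f zero    = ℕ.m≤m+n (f zero) _
  ≤-Σℕ f (suc i) = ℕ.≤-trans (≤-Σℕ (tail f) i) (ℕ.m≤n+m _ (f zero))

  -- Every variable in the support is hit by an input wire. After exchanging the sums, each wire
  -- hits exactly one variable and has weight at least 1, so the support is at most the total
  -- weight.
  support-size : (g : Gate k (Fin n)) → ∑χ (support g) ≤ + k
  support-size {k} {n} g = subst (λ z → z ≤ + k) (sym (sum-pos (λ i → bit (support g i)))) (+≤+ (begin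
    Σℕ (λ i → bit (support g i))                      ≤⟨ Σℕ-mono covered ⟩
    Σℕ (λ i → Σℕ (λ j → bit (does (input j ≟ i))))    ≡⟨ Σℕ.∑-comm (λ i j → bit (does (input j ≟ i))) ⟩
    Σℕ (λ j → Σℕ (λ i → bit (does (input j ≟ i))))    ≡⟨ Σℕ.sum-cong-≗ (λ j → Σ-≟ (input j)) ⟩
    Σℕ {arity} (λ _ → 1)                                      ≤⟨ Σℕ-mono {arity} {λ _ → 1} weight>0 ⟩
    Σℕ weight                                         ≤⟨ weight≤k ⟩
    k                                                 ∎))
    where
    open Gate g
    open ℕ.≤-Reasoning
    covered : ∀ i → bit (support g i) ℕ.≤ Σℕ (λ j → bit (does (input j ≟ i)))
    covered i with any? (λ j → input j ≟ i)
    ... | no _ = z≤n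
    ... | yes (j , eq) = ℕ.≤-trans (hit (input j ≟ i)) (≤-Σℕ (λ j → bit (does (input j ≟ i))) j)
      where
      hit : (d : Dec (input j ≡ i)) → 1 ℕ.≤ bit (does d)
      hit (yes _) = ℕ.≤-refl
      hit (no ≢)  = contradiction eq ≢

  -- If the output of the circuit changes along an edge of the cube then so does
  -- the output of some bottom gate, and by monotonicity all changes have the same sign.
  circuit-edge : ∀ (C : MAJ∘MAJ-Circuit k n) A i → let A′ = A [ i ]≔ false in
    χ (evalCircuit C A) - χ (evalCircuit C A′) ≤
    sum (λ j → χ (evalGate (lookup A) (Gate.input C j)) - χ (evalGate (lookup A′) (Gate.input C j)))
  circuit-edge C A i = from-dec (all? same?)
    where
    open Gate C
    A′ = A [ i ]≔ false
    before after : Fin arity → Bool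
    before j = evalGate (lookup A) (input j)
    after j = evalGate (lookup A′) (input j)
    same? : ∀ j → Dec (before j ≡ after j)
    same? j = before j ≟ᵇ after j
    diff : Fin arity → ℤ
    diff j = χ (before j) - χ (after j)
    diff-nonNeg : ∀ j → 0ℤ ≤ diff j
    diff-nonNeg j = ℤ.i≤j⇒0≤j-i (+≤+ (evalGate-mono (input j) (flip-≤ A i)))
    ≤1 : ∀ b c → χ b - χ c ≤ 1ℤ
    ≤1 true  true  = +≤+ z≤n
    ≤1 true  false = ℤ.≤-refl
    ≤1 false true  = -≤+
    ≤1 false false = +≤+ z≤n
    1≤ : ∀ b c → b ≢ c → 0ℤ ≤ χ b - χ c → 1ℤ ≤ χ b - χ c
    1≤ true  true  b≢c _ = contradiction refl b≢c
    1≤ true  false _   _ = ℤ.≤-refl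
    1≤ false true  _   ()
    1≤ false false b≢c _ = contradiction refl b≢c
    from-dec : Dec (∀ j → before j ≡ after j) → χ (evalCircuit C A) - χ (evalCircuit C A′) ≤ sum diff
    from-dec (yes same) = subst (λ z → z ≤ sum diff)
      (sym (trans
        (cong (λ b → χ b - χ (evalCircuit C A′))
          (evalGate-cong (evalGate (lookup A)) (evalGate (lookup A′)) C same))
        (ℤ.+-inverseʳ (χ (evalCircuit C A′)))))
      (sum-nonNeg diff-nonNeg)
    from-dec (no ¬same) with ¬∀⟶∃¬ arity _ same? ¬same
    ... | j , changed = ℤ.≤-trans (≤1 (evalCircuit C A) (evalCircuit C A′))
      (ℤ.≤-trans (1≤ (before j) (after j) changed (diff-nonNeg j)) (≤-sum diff-nonNeg j))

  module _ (w : ℕ → ℤ) (0≤w : ∀ j → 0ℤ ≤ w j) (C : MAJ∘MAJ-Circuit k n) where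
    open Gate C using (arity; input)

    private
      Γ : Fin arity → Assignment n → ℤ
      Γ j A = χ (evalGate (lookup A) (input j))

    circuit-edges : sum (edges w (χ ∘ evalCircuit C)) ≤ sum (λ j → sum (edges w (Γ j)))
    circuit-edges = begin
      sum (edges w (χ ∘ evalCircuit C))
        ≤⟨ sum-mono (λ i → ∑ᶜ-mono (λ A → ℤ.*-monoˡ-≤-nonNeg (w ∣ A ∣) {{nonNegative (0≤w ∣ A ∣)}}
             (ℤ.*-monoˡ-≤-nonNeg (χ (lookup A i)) (circuit-edge C A i)))) ⟩
      sum (λ i → ∑ᶜ (λ A → w ∣ A ∣ * (χ (lookup A i) * sum (λ j → Γ j A - Γ j (A [ i ]≔ false)))))
        ≡⟨ sum-cong-≗ (λ i → ∑ᶜ-cong (λ A → pull A i)) ⟩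
      sum (λ i → ∑ᶜ (λ A → sum (λ j → w ∣ A ∣ * (χ (lookup A i) * (Γ j A - Γ j (A [ i ]≔ false))))))
        ≡⟨ sum-cong-≗ (λ i → ∑ᶜ-sum (λ j A → w ∣ A ∣ * (χ (lookup A i) * (Γ j A - Γ j (A [ i ]≔ false))))) ⟩
      sum (λ i → sum (λ j → edges w (Γ j) i))
        ≡⟨ ∑-comm (λ i j → edges w (Γ j) i) ⟩
      sum (λ j → sum (edges w (Γ j))) ∎
      where
      open ℤ.≤-Reasoning
      pull : ∀ A i → w ∣ A ∣ * (χ (lookup A i) * sum (λ j → Γ j A - Γ j (A [ i ]≔ false))) ≡
        sum (λ j → w ∣ A ∣ * (χ (lookup A i) * (Γ j A - Γ j (A [ i ]≔ false))))
      pull A i = trans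
        (cong (λ z → w ∣ A ∣ * z) (*-distribˡ-sum (χ (lookup A i)) (λ j → Γ j A - Γ j (A [ i ]≔ false))))
        (*-distribˡ-sum (w ∣ A ∣) (λ j → χ (lookup A i) * (Γ j A - Γ j (A [ i ]≔ false))))

  -- A union bound: the sensitive edges of the circuit are covered by those of its bottom gates, and
  -- each such gate has support at most k and so obeys `influence-bound`.
  circuit-influence : ∀ m w → (∀ j → 0ℤ ≤ w j) → (C : MAJ∘MAJ-Circuit k (2 ℕ.+ m)) → + 2 * + k ≤ + (2 ℕ.+ m) →
    let n″ = + (2 ℕ.+ m) in
    + 20 * n″ * + k * sum (edges w (χ ∘ evalCircuit C)) ≤
    + k * ((n″ * n″ + + 100 * (+ k * + k * + k)) * (layers (2 ℕ.+ m) w + layers (2 ℕ.+ m) (shift w)))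
  circuit-influence {k} m w 0≤w C 2k≤n = begin
    c * sum (edges w (χ ∘ evalCircuit C))
      ≤⟨ ℤ.*-monoˡ-≤-nonNeg c {{nonNegative 0≤c}} (circuit-edges w 0≤w C) ⟩
    c * sum (λ j → T j)
      ≡⟨ *-distribˡ-sum c T ⟩
    sum (λ j → c * T j)
      ≤⟨ sum-mono (λ j → influence-bound m w 0≤w (λ A → evalGate (lookup A) (input j)) (support (input j))
           (support-depends (input j)) (+ k) (support-size (input j)) 2k≤n) ⟩
    sum {arity} (λ _ → bound)
      ≡⟨ sum-const arity bound ⟩
    + arity * bound
      -- All weights of the top gate are at least 1, so it has at most k inputs.
      ≤⟨ ℤ.*-monoʳ-≤-nonNeg bound {{nonNegative 0≤bound}} (+≤+ (arity≤k C)) ⟩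
    + k * bound ∎
    where
    open Gate C using (arity; input)
    open ℤ.≤-Reasoning
    n″ = + (2 ℕ.+ m)
    c = + 20 * n″ * + k
    T : Fin arity → ℤ
    T j = sum (edges w (λ A → χ (evalGate (lookup A) (input j))))
    bound = (n″ * n″ + + 100 * (+ k * + k * + k)) * (layers (2 ℕ.+ m) w + layers (2 ℕ.+ m) (shift w))
    0≤k : 0ℤ ≤ + k
    0≤k = +≤+ z≤n
    0≤c : 0ℤ ≤ c
    0≤c = *-nonNeg {+ 20 * n″} (+≤+ z≤n) 0≤k
    0≤bound : 0ℤ ≤ bound
    0≤bound = *-nonNeg
      (ℤ.+-mono-≤ (square-nonNeg n″) (*-nonNeg {+ 100} (+≤+ z≤n) (*-nonNeg (square-nonNeg (+ k)) 0≤k)))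
      (ℤ.+-mono-≤ (layers-nonNeg (2 ℕ.+ m) w 0≤w) (layers-nonNeg (2 ℕ.+ m) (shift w) (λ j → 0≤w (suc j))))

  -- Lengths of filtered lists as sums over the cube.

  ∑ˡ : (X → ℤ) → List X → ℤ
  ∑ˡ f []       = 0ℤ
  ∑ˡ f (x ∷ xs) = f x + ∑ˡ f xs

  ∑ˡ-++ : ∀ (f : X → ℤ) xs ys → ∑ˡ f (xs ++ ys) ≡ ∑ˡ f xs + ∑ˡ f ys
  ∑ˡ-++ f []       ys = sym (ℤ.+-identityˡ (∑ˡ f ys))
  ∑ˡ-++ f (x ∷ xs) ys = trans (cong (_+_ (f x)) (∑ˡ-++ f xs ys)) (sym (ℤ.+-assoc (f x) (∑ˡ f xs) (∑ˡ f ys)))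

  ∑ˡ-map : ∀ (f : Y → ℤ) (g : X → Y) xs → ∑ˡ f (map g xs) ≡ ∑ˡ (f ∘ g) xs
  ∑ˡ-map f g []       = refl
  ∑ˡ-map f g (x ∷ xs) = cong (_+_ (f (g x))) (∑ˡ-map f g xs)

  ∑ˡ-filter : ∀ {Q : X → Set} (Q? : Decidable Q) (f : X → ℤ) xs →
    ∑ˡ f (filter Q? xs) ≡ ∑ˡ (λ x → χ (does (Q? x)) * f x) xs
  ∑ˡ-filter Q? f [] = refl
  ∑ˡ-filter Q? f (x ∷ xs) with does (Q? x)
  ... | true  = cong₂ _+_ (sym (ℤ.*-identityˡ (f x))) (∑ˡ-filter Q? f xs)
  ... | false = trans (∑ˡ-filter Q? f xs) (trans (sym (ℤ.+-identityˡ _))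
    (cong (λ z → z + ∑ˡ (λ x → χ (does (Q? x)) * f x) xs) (sym (ℤ.*-zeroˡ (f x)))))

  ∑ˡ-length : ∀ (xs : List X) → + length xs ≡ ∑ˡ (λ _ → 1ℤ) xs
  ∑ˡ-length []       = refl
  ∑ˡ-length (x ∷ xs) = cong (_+_ 1ℤ) (∑ˡ-length xs)

  ∑ˡ-assignments : ∀ n (F : Assignment n → ℤ) → ∑ˡ F (assignments n) ≡ ∑ᶜ F
  ∑ˡ-assignments zero    F = trans (ℤ.+-identityʳ (F [])) (sym (∑ᶜ-[] F))
  ∑ˡ-assignments (suc n) F = begin
    ∑ˡ F (map (false ∷_) As ++ (map (true ∷_) As ++ []))
      ≡⟨ ∑ˡ-++ F (map (false ∷_) As) _ ⟩
    ∑ˡ F (map (false ∷_) As) + ∑ˡ F (map (true ∷_) As ++ [])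
      ≡⟨ cong (_+_ (∑ˡ F (map (false ∷_) As))) (trans (∑ˡ-++ F (map (true ∷_) As) []) (ℤ.+-identityʳ _)) ⟩
    ∑ˡ F (map (false ∷_) As) + ∑ˡ F (map (true ∷_) As)
      ≡⟨ cong₂ _+_ (trans (∑ˡ-map F (false ∷_) As) (∑ˡ-assignments n (λ A → F (false ∷ A))))
                   (trans (∑ˡ-map F (true ∷_) As) (∑ˡ-assignments n (λ A → F (true ∷ A)))) ⟩
    ∑ᶜ (λ A → F (false ∷ A)) + ∑ᶜ (λ A → F (true ∷ A))
      ≡⟨ ∑ᶜ-∷ F ⟨
    ∑ᶜ F ∎
    where
    open ≡-Reasoning
    As = assignments n

  -- Minterms, maxterms and correct terms in terms of the middle layers.

  ⌊⌋-true : (d : Dec X) → X → ⌊ d ⌋ ≡ true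
  ⌊⌋-true (yes _) _ = refl
  ⌊⌋-true (no ¬p) p = contradiction p ¬p

  ⌊⌋-false : (d : Dec X) → ¬ X → ⌊ d ⌋ ≡ false
  ⌊⌋-false (yes p) ¬p = contradiction p ¬p
  ⌊⌋-false (no _)  _  = refl

  ⌊⌋-true⁻¹ : (d : Dec X) → ⌊ d ⌋ ≡ true → X
  ⌊⌋-true⁻¹ (yes p) _ = p

  ⌊⌋-false⁻¹ : (d : Dec X) → ⌊ d ⌋ ≡ false → ¬ X
  ⌊⌋-false⁻¹ (no ¬p) _ = ¬p

  MAJ-true : (A : Assignment n) → n ℕ.≤ 2 ℕ.* ∣ A ∣ → MAJ A ≡ true
  MAJ-true A = ⌊⌋-true (_ ℕ.≤? 2 ℕ.* ∣ A ∣)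

  MAJ-false : (A : Assignment n) → 2 ℕ.* ∣ A ∣ ℕ.< n → MAJ A ≡ false
  MAJ-false A lt = ⌊⌋-false (_ ℕ.≤? 2 ℕ.* ∣ A ∣) (ℕ.<⇒≱ lt)

  MAJ-true⁻¹ : (A : Assignment n) → MAJ A ≡ true → n ℕ.≤ 2 ℕ.* ∣ A ∣
  MAJ-true⁻¹ A = ⌊⌋-true⁻¹ (_ ℕ.≤? 2 ℕ.* ∣ A ∣)

  MAJ-false⁻¹ : (A : Assignment n) → MAJ A ≡ false → 2 ℕ.* ∣ A ∣ ℕ.< n
  MAJ-false⁻¹ A eq = ℕ.≰⇒> (⌊⌋-false⁻¹ (_ ℕ.≤? 2 ℕ.* ∣ A ∣) eq)

  ∣∣-raise : ∀ (A : Assignment n) i → lookup A i ≡ false → ∣ A [ i ]≔ true ∣ ≡ suc ∣ A ∣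
  ∣∣-raise (false ∷ A) zero    refl = refl
  ∣∣-raise (false ∷ A) (suc i) eq   = ∣∣-raise A i eq
  ∣∣-raise (true ∷ A)  (suc i) eq   = cong suc (∣∣-raise A i eq)

  ∃-true : (A : Assignment n) → 0 ℕ.< ∣ A ∣ → ∃[ i ] lookup A i ≡ true
  ∃-true (true ∷ A)  _   = zero , refl
  ∃-true (false ∷ A) 0<A = let i , eq = ∃-true A 0<A in suc i , eq

  ∃-false : (A : Assignment n) → ∣ A ∣ ℕ.< n → ∃[ i ] lookup A i ≡ false
  ∃-false (false ∷ A) _         = zero , refl
  ∃-false (true ∷ A)  (s≤s A<n) = let i , eq = ∃-false A A<n in suc i , eq

  -- The minterms of MAJₙ have weight j, and its maxterms weight j ∸ 1, for the j with Middle n j.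
  Middle : ℕ → ℕ → Set
  Middle n j = n ℕ.≤ 2 ℕ.* j × 2 ℕ.* j ℕ.< 2 ℕ.+ n

  middle? : ∀ n j → Dec (Middle n j)
  middle? n j = (n ℕ.≤? 2 ℕ.* j) ×-dec (2 ℕ.* j ℕ.<? 2 ℕ.+ n)

  2*suc : ∀ j → 2 ℕ.* suc j ≡ 2 ℕ.+ 2 ℕ.* j
  2*suc j = ℕ.*-suc 2 j

  -- Majority sees only the weight, so minimality tested at one 1 of A already gives the upper bound
  -- on the weight. In positive dimension an accepted A has such a 1.
  minterm⇔ : (A : Assignment (suc n)) → IsMinterm A ⇔ Middle (suc n) ∣ A ∣
  minterm⇔ {n} A = mk⇔ to from
    where
    to : IsMinterm A → Middle (suc n) ∣ A ∣
    to (maj , min) = MAJ-true⁻¹ A maj ,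
      subst (λ z → 2 ℕ.* z ℕ.< 3 ℕ.+ n) (sym (∣∣-flip A i Ai))
        (subst (ℕ._< 3 ℕ.+ n) (sym (2*suc ∣ A [ i ]≔ false ∣))
          (s≤s (s≤s (MAJ-false⁻¹ (A [ i ]≔ false) (min i Ai)))))
      where
      0<A : 0 ℕ.< ∣ A ∣
      0<A with ∣ A ∣ | MAJ-true⁻¹ A maj
      ... | suc _ | _ = s≤s z≤n
      i = proj₁ (∃-true A 0<A)
      Ai = proj₂ (∃-true A 0<A)
    from : Middle (suc n) ∣ A ∣ → IsMinterm A
    from (n≤ , <n) = MAJ-true A n≤ , λ i Ai → MAJ-false (A [ i ]≔ false)
      (ℕ.≤-pred (ℕ.≤-pred (subst (ℕ._< 3 ℕ.+ n)
        (trans (cong (2 ℕ.*_) (∣∣-flip A i Ai)) (2*suc ∣ A [ i ]≔ false ∣)) <n)))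

  -- Dual to `minterm⇔`: a rejected A has weight below n, so there is a 0 at which to test
  -- maximality.
  maxterm⇔ : (A : Assignment n) → IsMaxterm A ⇔ Middle n (suc ∣ A ∣)
  maxterm⇔ {n} A = mk⇔ to from
    where
    to : IsMaxterm A → Middle n (suc ∣ A ∣)
    to (¬maj , max) = subst (λ z → n ℕ.≤ 2 ℕ.* z) (∣∣-raise A i Ai) (MAJ-true⁻¹ (A [ i ]≔ true) (max i Ai)) ,
      subst (ℕ._< 2 ℕ.+ n) (sym (2*suc ∣ A ∣)) (s≤s (s≤s (MAJ-false⁻¹ A ¬maj)))
      where
      A<n : ∣ A ∣ ℕ.< n
      A<n = ℕ.≤-<-trans (ℕ.m≤m+n ∣ A ∣ _) (MAJ-false⁻¹ A ¬maj)
      i = proj₁ (∃-false A A<n)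
      Ai = proj₂ (∃-false A A<n)
    from : Middle n (suc ∣ A ∣) → IsMaxterm A
    from (n≤ , <n) = MAJ-false A (ℕ.≤-pred (ℕ.≤-pred (subst (ℕ._< 2 ℕ.+ n) (2*suc ∣ A ∣) <n))) ,
      λ i Ai → MAJ-true (A [ i ]≔ true) (subst (λ z → n ℕ.≤ 2 ℕ.* z) (sym (∣∣-raise A i Ai)) n≤)

  -- The weight function for all the edge counts: `mid n` selects the minterms, `shift (mid n)` the
  -- maxterms, and `edges (mid n)` the edges between them.
  mid : ℕ → ℕ → ℤ
  mid n j = χ (does (middle? n j))

  -- The numbers 2j and 2j + 2 cannot both lie in a window of two consecutive integers. Hence no
  -- assignment is counted as both a minterm and a maxterm.
  middle-unique : ∀ n j → Middle n j → ¬ Middle n (suc j)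
  middle-unique n j (n≤ , _) (_ , <n) =
    ℕ.<⇒≱ (ℕ.≤-pred (ℕ.≤-pred (subst (ℕ._< 2 ℕ.+ n) (2*suc j) <n))) n≤

  χ-minMaxTerm : (A : Assignment (suc n)) →
    χ (does (isMinterm? A ⊎-dec isMaxterm? A)) ≡ (mid (suc n) ∣ A ∣) + (shift (mid (suc n)) ∣ A ∣)
  χ-minMaxTerm {n} A = trans
    (cong₂ (λ a b → χ (a ∨ b)) (does-⇔ (minterm⇔ A) (isMinterm? A) (middle? (suc n) ∣ A ∣))
                               (does-⇔ (maxterm⇔ A) (isMaxterm? A) (middle? (suc n) (suc ∣ A ∣))))
    (disjoint (middle? (suc n) ∣ A ∣) (middle? (suc n) (suc ∣ A ∣)))
    where
    disjoint : (p : Dec (Middle (suc n) ∣ A ∣)) (q : Dec (Middle (suc n) (suc ∣ A ∣))) →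
      χ (does p ∨ does q) ≡ χ (does p) + χ (does q)
    disjoint (yes p) (yes q) = contradiction q (middle-unique (suc n) ∣ A ∣ p)
    disjoint (yes _) (no _)  = refl
    disjoint (no _)  (yes _) = refl
    disjoint (no _)  (no _)  = refl

  length-minMaxTerms : ∀ n → + length (minMaxTerms (suc n)) ≡
    layers (suc n) (mid (suc n)) + layers (suc n) (shift (mid (suc n)))
  length-minMaxTerms n = begin
    + length (minMaxTerms (suc n))
      ≡⟨ ∑ˡ-length (minMaxTerms (suc n)) ⟩
    ∑ˡ (λ _ → 1ℤ) (minMaxTerms (suc n))
      ≡⟨ ∑ˡ-filter (λ A → isMinterm? A ⊎-dec isMaxterm? A) (λ _ → 1ℤ) (assignments (suc n)) ⟩
    ∑ˡ (λ A → term A * 1ℤ) (assignments (suc n))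
      ≡⟨ ∑ˡ-assignments (suc n) (λ A → term A * 1ℤ) ⟩
    ∑ᶜ (λ A → term A * 1ℤ)
      ≡⟨ ∑ᶜ-cong (λ A → trans (ℤ.*-identityʳ (term A)) (χ-minMaxTerm A)) ⟩
    ∑ᶜ {suc n} (λ A → (mid (suc n) ∣ A ∣) + (shift (mid (suc n)) ∣ A ∣))
      ≡⟨ ∑ᶜ-+ {suc n} (λ A → mid (suc n) ∣ A ∣) (λ A → shift (mid (suc n)) ∣ A ∣) ⟩
    layers (suc n) (mid (suc n)) + layers (suc n) (shift (mid (suc n))) ∎
    where
    open ≡-Reasoning
    term : Assignment (suc n) → ℤ
    term A = χ (does (isMinterm? A ⊎-dec isMaxterm? A))

  -- Being correct means accepting on a minterm and rejecting on a maxterm. The factor `1ℤ` is the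
  -- constant summand left over from counting a list with `∑ˡ-filter`.
  χ-correct : ∀ n (A : Assignment n) c → ((mid n ∣ A ∣) + (shift (mid n) ∣ A ∣)) * (χ (does (c ≟ᵇ MAJ A)) * 1ℤ) ≡
    mid n ∣ A ∣ * χ c + ((shift (mid n) ∣ A ∣) - shift (mid n) ∣ A ∣ * χ c)
  χ-correct n A c = by-cases (middle? n ∣ A ∣) (middle? n (suc ∣ A ∣))
    where
    agree-true : ∀ c {b} → b ≡ true → χ (does (c ≟ᵇ b)) ≡ χ c
    agree-true true  refl = refl
    agree-true false refl = refl
    agree-false : ∀ c {b} → b ≡ false → χ (does (c ≟ᵇ b)) ≡ 1ℤ - χ c
    agree-false true  refl = refl
    agree-false false refl = refl
    min : ∀ z → (1ℤ + 0ℤ) * (z * 1ℤ) ≡ 1ℤ * z + (0ℤ - 0ℤ * z)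
    min = solve-∀
    max : ∀ z → (0ℤ + 1ℤ) * ((1ℤ - z) * 1ℤ) ≡ 0ℤ * z + (1ℤ - 1ℤ * z)
    max = solve-∀
    neither : ∀ y z → (0ℤ + 0ℤ) * (y * 1ℤ) ≡ 0ℤ * z + (0ℤ - 0ℤ * z)
    neither = solve-∀
    by-cases : (p : Dec (Middle n ∣ A ∣)) (q : Dec (Middle n (suc ∣ A ∣))) →
      (χ (does p) + χ (does q)) * (χ (does (c ≟ᵇ MAJ A)) * 1ℤ) ≡
      χ (does p) * χ c + (χ (does q) - χ (does q) * χ c)
    by-cases (yes p) (yes q) = contradiction q (middle-unique n ∣ A ∣ p)
    by-cases (yes (n≤ , _)) (no _) =
      trans (cong (λ z → (1ℤ + 0ℤ) * (z * 1ℤ)) (agree-true c (MAJ-true A n≤))) (min (χ c))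
    by-cases (no _) (yes (_ , <n)) =
      trans (cong (λ z → (0ℤ + 1ℤ) * (z * 1ℤ)) (agree-false c
        (MAJ-false A (ℕ.≤-pred (ℕ.≤-pred (subst (ℕ._< 2 ℕ.+ n) (2*suc ∣ A ∣) <n)))))) (max (χ c))
    by-cases (no _) (no _) = neither (χ (does (c ≟ᵇ MAJ A))) (χ c)

  ∑χ-accepted : (ℕ → ℤ) → (Assignment n → Bool) → ℤ
  ∑χ-accepted w φ = ∑ᶜ (λ A → w ∣ A ∣ * χ (φ A))

  length-correctTerms : (C : MAJ∘MAJ-Circuit k (suc n)) → let w = mid (suc n) in
    + length (correctTerms C) ≡ ∑χ-accepted w (evalCircuit C) +
      (layers (suc n) (shift w) - ∑χ-accepted (shift w) (evalCircuit C))
  length-correctTerms {n = n} C = begin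
    + length (correctTerms C)
      ≡⟨ ∑ˡ-length (correctTerms C) ⟩
    ∑ˡ (λ _ → 1ℤ) (correctTerms C)
      ≡⟨ ∑ˡ-filter (λ A → evalCircuit C A ≟ᵇ MAJ A) (λ _ → 1ℤ) (minMaxTerms (suc n)) ⟩
    ∑ˡ (λ A → correct A * 1ℤ) (minMaxTerms (suc n))
      ≡⟨ ∑ˡ-filter (λ A → isMinterm? A ⊎-dec isMaxterm? A) (λ A → correct A * 1ℤ) (assignments (suc n)) ⟩
    ∑ˡ (λ A → term A * (correct A * 1ℤ)) (assignments (suc n))
      ≡⟨ ∑ˡ-assignments (suc n) (λ A → term A * (correct A * 1ℤ)) ⟩
    ∑ᶜ (λ A → term A * (correct A * 1ℤ))
      ≡⟨ ∑ᶜ-cong (λ A → trans (cong (λ z → z * (correct A * 1ℤ)) (χ-minMaxTerm A))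
           (χ-correct (suc n) A (evalCircuit C A))) ⟩
    ∑ᶜ (λ A → w ∣ A ∣ * χ (evalCircuit C A) + ((shift w ∣ A ∣) - shift w ∣ A ∣ * χ (evalCircuit C A)))
      ≡⟨ ∑ᶜ-+ (λ A → w ∣ A ∣ * χ (evalCircuit C A)) (λ A → (shift w ∣ A ∣) - shift w ∣ A ∣ * χ (evalCircuit C A)) ⟩
    ∑χ-accepted w (evalCircuit C) + ∑ᶜ (λ A → (shift w ∣ A ∣) - shift w ∣ A ∣ * χ (evalCircuit C A))
      ≡⟨ cong (_+_ (∑χ-accepted w (evalCircuit C)))
           (∑ᶜ-- (λ A → shift w ∣ A ∣) (λ A → shift w ∣ A ∣ * χ (evalCircuit C A))) ⟩
    ∑χ-accepted w (evalCircuit C) + (layers (suc n) (shift w) - ∑χ-accepted (shift w) (evalCircuit C)) ∎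
    where
    open ≡-Reasoning
    w = mid (suc n)
    term correct : Assignment (suc n) → ℤ
    term A = χ (does (isMinterm? A ⊎-dec isMaxterm? A))
    correct A = χ (does (evalCircuit C A ≟ᵇ MAJ A))

  -- Lower bound on the sensitive edges of an accurate function.

  edges-∣∣ : ∀ w (φ : Assignment n → ℤ) → sum (edges w φ) ≡
    ∑ᶜ (λ A → w ∣ A ∣ * φ A * + ∣ A ∣) - ∑ᶜ (λ B → shift w ∣ B ∣ * φ B * (+ n - + ∣ B ∣))
  edges-∣∣ {n} w φ = begin
    sum (edges w φ)
      ≡⟨ sum-cong-≗ (λ i → sym (ℤ.*-identityˡ (edges w φ i))) ⟩
    sum (λ i → 1ℤ * edges w φ i)
      ≡⟨ edges-weighted w φ (λ _ → 1ℤ) ⟩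
    ∑ᶜ (λ A → w ∣ A ∣ * φ A * ⟨ (λ _ → 1ℤ) , A ⟩) -
    ∑ᶜ (λ B → shift w ∣ B ∣ * φ B * (sum {n} (λ _ → 1ℤ) - ⟨ (λ _ → 1ℤ) , B ⟩))
      ≡⟨ cong₂ _-_ (∑ᶜ-cong (λ A → cong (λ z → w ∣ A ∣ * φ A * z) (⟨1⟩ A)))
           (∑ᶜ-cong (λ B → cong (λ z → shift w ∣ B ∣ * φ B * z)
             (cong₂ _-_ (trans (sum-const n 1ℤ) (ℤ.*-identityʳ (+ n))) (⟨1⟩ B)))) ⟩
    ∑ᶜ (λ A → w ∣ A ∣ * φ A * + ∣ A ∣) - ∑ᶜ (λ B → shift w ∣ B ∣ * φ B * (+ n - + ∣ B ∣)) ∎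
    where
    open ≡-Reasoning
    ⟨1⟩ : ∀ A → ⟨ (λ _ → 1ℤ) , A ⟩ ≡ + ∣ A ∣
    ⟨1⟩ A = trans (sum-cong-≗ (λ i → ℤ.*-identityˡ (χ (lookup A i)))) (sum-pos (λ i → bit (lookup A i)))

  -- Used to replace degrees by constants; `a` and `c` clear the denominator 2. The factor `u j` in
  -- the hypothesis restricts the comparison to the selected layer.
  ∑ᶜ-bound : ∀ (u : ℕ → ℤ) (φ : Assignment n → Bool) a c (f g : ℕ → ℤ) →
    (∀ j → 0ℤ ≤ u j * (c * g j - a * f j)) →
    a * ∑ᶜ (λ A → u ∣ A ∣ * χ (φ A) * f ∣ A ∣) ≤ c * ∑ᶜ (λ A → u ∣ A ∣ * χ (φ A) * g ∣ A ∣)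
  ∑ᶜ-bound u φ a c f g pointwise = subst₂ _≤_
    (∑ᶜ-* a (λ A → u ∣ A ∣ * χ (φ A) * f ∣ A ∣)) (∑ᶜ-* c (λ A → u ∣ A ∣ * χ (φ A) * g ∣ A ∣))
    (∑ᶜ-mono (λ A → certify-≤ (split a c (u ∣ A ∣) (χ (φ A)) (f ∣ A ∣) (g ∣ A ∣))
      (*-nonNeg {χ (φ A)} (+≤+ z≤n) (pointwise ∣ A ∣))))
    where
    split : ∀ a c u x f g → c * (u * x * g) ≡ a * (u * x * f) + x * (u * (c * g - a * f))
    split = solve-∀

  mid-nonNeg : ∀ n {f : ℤ} j → (Middle n j → 0ℤ ≤ f) → 0ℤ ≤ mid n j * f
  mid-nonNeg n {f} j 0≤f = by-cases (middle? n j)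
    where
    by-cases : (d : Dec (Middle n j)) → 0ℤ ≤ χ (does d) * f
    by-cases (yes p) = subst (0ℤ ≤_) (sym (ℤ.*-identityˡ f)) (0≤f p)
    by-cases (no _)  = subst (0ℤ ≤_) (sym (ℤ.*-zeroˡ f)) ℤ.≤-refl

  module _ (n j : ℕ) where
    private
      n≤⇒ : n ℕ.≤ 2 ℕ.* j → 0ℤ ≤ + 2 * + j - + n
      n≤⇒ n≤ = ℤ.i≤j⇒0≤j-i (subst (+ n ≤_) (ℤ.pos-* 2 j) (+≤+ n≤))
      <n⇒ : 2 ℕ.* j ℕ.< 2 ℕ.+ n → 0ℤ ≤ + 1 + + n - + 2 * + j
      <n⇒ <n = ℤ.i≤j⇒0≤j-i (subst (_≤ + suc n) (ℤ.pos-* 2 j) (+≤+ (ℕ.≤-pred <n)))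

    -- A minterm has j ones, where n ≤ 2j ≤ n + 1; this and `middle-upper` are the two halves. The
    -- factor `1ℤ` is the constant function fed to `∑ᶜ-bound`.
    middle-lower : Middle n j → 0ℤ ≤ + 2 * + j - + n * 1ℤ
    middle-lower (n≤ , _) = subst (0ℤ ≤_) (regroup (+ n) (+ j)) (n≤⇒ n≤)
      where
      regroup : ∀ n j → + 2 * j - n ≡ + 2 * j - n * 1ℤ
      regroup = solve-∀

    middle-upper : Middle n j → 0ℤ ≤ (+ 1 + + n) * 1ℤ - + 2 * + j
    middle-upper (_ , <n) = subst (0ℤ ≤_) (regroup (+ n) (+ j)) (<n⇒ <n)
      where
      regroup : ∀ n j → + 1 + n - + 2 * j ≡ (+ 1 + n) * 1ℤ - + 2 * j
      regroup = solve-∀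

  -- A maxterm of weight j has n - j zeros, where n + 1 ≤ 2(n - j) ≤ n + 2; the lower half is
  -- `middle-co-lower`.
  middle-co-upper : ∀ n j → Middle n (suc j) → 0ℤ ≤ (+ 2 + + n) * 1ℤ - + 2 * (+ n - + j)
  middle-co-upper n j p = subst (0ℤ ≤_) (regroup (+ n) (+ j)) (middle-lower n (suc j) p)
    where
    regroup : ∀ n j → + 2 * (+ 1 + j) - n * 1ℤ ≡ (+ 2 + n) * 1ℤ - + 2 * (n - j)
    regroup = solve-∀

  middle-co-lower : ∀ n j → Middle n (suc j) → 0ℤ ≤ + 2 * (+ n - + j) - (+ 1 + + n) * 1ℤ
  middle-co-lower n j p = subst (0ℤ ≤_) (regroup (+ n) (+ j)) (middle-upper n (suc j) p)
    where
    regroup : ∀ n j → (+ 1 + n) * 1ℤ - + 2 * (+ 1 + j) ≡ + 2 * (n - j) - (+ 1 + n) * 1ℤ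
    regroup = solve-∀

  ∑χ-accepted-*1 : ∀ w (φ : Assignment n → Bool) → ∑ᶜ (λ A → w ∣ A ∣ * χ (φ A) * 1ℤ) ≡ ∑χ-accepted w φ
  ∑χ-accepted-*1 w φ = ∑ᶜ-cong (λ A → ℤ.*-identityʳ (w ∣ A ∣ * χ (φ A)))

  module _ (n : ℕ) where
    private
      w = mid n
      N₁ = layers n w
      N₀ = layers n (shift w)

    mid-≥0 : ∀ j → 0ℤ ≤ w j
    mid-≥0 j = +≤+ z≤n

    -- Each accepted minterm is the top of at least n/2 edges, and each accepted maxterm is the
    -- bottom of at most (n + 2)/2 edges, which are subtracted.
    edges-lower : ∀ (φ : Assignment n → Bool) →
      + n * ∑χ-accepted w φ - (+ 2 + + n) * ∑χ-accepted (shift w) φ ≤ + 2 * sum (edges w (χ ∘ φ))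
    edges-lower φ = subst ((+ n * ∑χ-accepted w φ - (+ 2 + + n) * ∑χ-accepted (shift w) φ) ≤_)
      (trans (sym (distribute (+ 2) U V)) (cong (λ z → + 2 * z) (sym (edges-∣∣ w (χ ∘ φ)))))
      (ℤ.+-mono-≤
        (subst (λ z → + n * z ≤ + 2 * U) (∑χ-accepted-*1 w φ)
          (∑ᶜ-bound w φ (+ n) (+ 2) (λ _ → 1ℤ) (λ j → + j) (λ j → mid-nonNeg n j (middle-lower n j))))
        (ℤ.neg-mono-≤ (subst (λ z → + 2 * V ≤ (+ 2 + + n) * z) (∑χ-accepted-*1 (shift w) φ)
          (∑ᶜ-bound (shift w) φ (+ 2) (+ 2 + + n) (λ j → + n - + j) (λ _ → 1ℤ)
            (λ j → mid-nonNeg n (suc j) (middle-co-upper n j))))))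
      where
      U = ∑ᶜ (λ A → w ∣ A ∣ * χ (φ A) * + ∣ A ∣)
      V = ∑ᶜ (λ B → shift w ∣ B ∣ * χ (φ B) * (+ n - + ∣ B ∣))
      distribute : ∀ a b c → a * (b - c) ≡ a * b - a * c
      distribute = solve-∀

    ∑χ-accepted-true : ∀ w → ∑χ-accepted {n} w (λ _ → true) ≡ layers n w
    ∑χ-accepted-true w = ∑ᶜ-cong {n} (λ A → ℤ.*-identityʳ (w ∣ A ∣))

    -- Count the edges between the two layers from both sides: a maxterm lies on at least (n + 1)/2
    -- of them, a minterm on at most (n + 1)/2.
    maxterms≤minterms : N₀ ≤ N₁
    maxterms≤minterms = ℤ.*-cancelˡ-≤-pos N₀ N₁ (+ 1 + + n) (begin
      (+ 1 + + n) * N₀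
        ≡⟨ cong (λ z → (+ 1 + + n) * z)
             (trans (∑χ-accepted-*1 {n} (shift w) (λ _ → true)) (∑χ-accepted-true (shift w))) ⟨
      (+ 1 + + n) * ∑ᶜ {n} (λ A → shift w ∣ A ∣ * 1ℤ * 1ℤ)
        ≤⟨ ∑ᶜ-bound {n} (shift w) (λ _ → true) (+ 1 + + n) (+ 2) (λ _ → 1ℤ) (λ j → + n - + j)
             (λ j → mid-nonNeg n (suc j) (middle-co-lower n j)) ⟩
      + 2 * V
        -- `U` and `V` both count all the edges; they agree because a constant function changes
        -- along none.
        ≡⟨ cong (λ z → + 2 * z) (sym (ℤ.i-j≡0⇒i≡j U V (trans (sym (edges-∣∣ {n} w (λ _ → 1ℤ))) edges-const))) ⟩
      + 2 * U
        ≤⟨ ∑ᶜ-bound {n} w (λ _ → true) (+ 2) (+ 1 + + n) (λ j → + j) (λ _ → 1ℤ)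
             (λ j → mid-nonNeg n j (middle-upper n j)) ⟩
      (+ 1 + + n) * ∑ᶜ {n} (λ A → w ∣ A ∣ * 1ℤ * 1ℤ)
        ≡⟨ cong (λ z → (+ 1 + + n) * z) (trans (∑χ-accepted-*1 {n} w (λ _ → true)) (∑χ-accepted-true w)) ⟩
      (+ 1 + + n) * N₁ ∎)
      where
      open ℤ.≤-Reasoning
      U = ∑ᶜ {n} (λ A → w ∣ A ∣ * 1ℤ * + ∣ A ∣)
      V = ∑ᶜ {n} (λ B → shift w ∣ B ∣ * 1ℤ * (+ n - + ∣ B ∣))
      vanish : ∀ a b → a * (b * (1ℤ - 1ℤ)) ≡ 0ℤ
      vanish = solve-∀
      edges-const : sum (edges {n} w (λ _ → 1ℤ)) ≡ 0ℤ
      edges-const = trans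
        (sum-cong-≗ (λ i → trans (∑ᶜ-cong (λ A → vanish (w ∣ A ∣) (χ (lookup A i)))) (∑ᶜ-zero n)))
        (trans (sum-const n 0ℤ) (ℤ.*-zeroʳ (+ n)))

    accepted≤ : ∀ (φ : Assignment n → Bool) → ∑χ-accepted w φ ≤ N₁
    accepted≤ φ = ∑ᶜ-mono (λ A → subst (w ∣ A ∣ * χ (φ A) ≤_) (ℤ.*-identityʳ (w ∣ A ∣))
      (ℤ.*-monoˡ-≤-nonNeg (w ∣ A ∣) (χ≤1 (φ A))))
      where
      χ≤1 : ∀ b → χ b ≤ 1ℤ
      χ≤1 true  = ℤ.≤-refl
      χ≤1 false = +≤+ z≤n

    -- Let c and e be the numbers of accepted minterms and maxterms, and N = N₁ + N₀. Correctness
    -- gives c - e ≥ 9N/10 - N₀ ≥ 2N/5, as N₀ ≤ N/2, and e ≤ N/10, as c ≤ N₁. So nc - (n + 2)e ≥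
    -- 2nN/5 - N/5, which is at least 3nN/10 once n ≥ 2.
    edges-many : ∀ (φ : Assignment n → Bool) → 2 ℕ.≤ n →
      + 9 * (N₁ + N₀) ≤ + 10 * (∑χ-accepted w φ + (N₀ - ∑χ-accepted (shift w) φ)) →
      + 3 * (+ n * (N₁ + N₀)) ≤ + 20 * sum (edges w (χ ∘ φ))
    edges-many φ 2≤n mostly = ℤ.≤-trans
      (certify-≤ (split (+ n) N₁ N₀ (∑χ-accepted w φ) (∑χ-accepted (shift w) φ)) slack)
      (subst (+ 10 * lower ≤_) (regroup (sum (edges w (χ ∘ φ)))) (ℤ.*-monoˡ-≤-nonNeg (+ 10) (edges-lower φ)))
      where
      lower = + n * ∑χ-accepted w φ - (+ 2 + + n) * ∑χ-accepted (shift w) φ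
      regroup : ∀ t → + 10 * (+ 2 * t) ≡ + 20 * t
      regroup = solve-∀
      split : ∀ n N₁ N₀ c e → + 10 * (n * c - (+ 2 + n) * e) ≡ + 3 * (n * (N₁ + N₀)) +
        ((+ 2 + n) * (+ 10 * (c + (N₀ - e)) - + 9 * (N₁ + N₀)) +
         (+ 20 * (N₁ - c) + ((+ 4 * n + + 2) * (N₁ - N₀) + + 2 * ((n - + 2) * N₁))))
      split = solve-∀
      slack : 0ℤ ≤ (+ 2 + + n) * (+ 10 * (∑χ-accepted w φ + (N₀ - ∑χ-accepted (shift w) φ)) - + 9 * (N₁ + N₀)) +
         (+ 20 * (N₁ - ∑χ-accepted w φ) + ((+ 4 * + n + + 2) * (N₁ - N₀) + + 2 * ((+ n - + 2) * N₁)))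
      slack = ℤ.+-mono-≤ (*-nonNeg {+ 2 + + n} (+≤+ z≤n) (ℤ.i≤j⇒0≤j-i mostly))
        (ℤ.+-mono-≤ (*-nonNeg {+ 20} (+≤+ z≤n) (ℤ.i≤j⇒0≤j-i (accepted≤ φ)))
          (ℤ.+-mono-≤ (*-nonNeg {+ 4 * + n + + 2}
              (ℤ.+-mono-≤ (*-nonNeg {+ 4} {+ n} (+≤+ z≤n) (+≤+ z≤n)) (+≤+ z≤n))
              (ℤ.i≤j⇒0≤j-i maxterms≤minterms))
            (*-nonNeg {+ 2} (+≤+ z≤n) (*-nonNeg (ℤ.i≤j⇒0≤j-i (+≤+ 2≤n)) (layers-nonNeg n w mid-≥0)))))

  -- Comparison of the two edge bounds.

  ≤-layers : ∀ n w → (∀ j → 0ℤ ≤ w j) → ∀ {j} → j ℕ.≤ n → w j ≤ layers n w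
  ≤-layers zero    w 0≤w z≤n = ℤ.≤-reflexive (sym (∑ᶜ-[] (λ A → w ∣ A ∣)))
  ≤-layers (suc n) w 0≤w {zero} _ = subst₂ _≤_ (ℤ.+-identityʳ (w 0)) (sym (layers-suc n w))
    (ℤ.+-mono-≤ (≤-layers n w 0≤w z≤n) (layers-nonNeg n (shift w) (λ j → 0≤w (suc j))))
  ≤-layers (suc n) w 0≤w {suc j} (s≤s j≤n) = subst₂ _≤_ (ℤ.+-identityˡ (w (suc j))) (sym (layers-suc n w))
    (ℤ.+-mono-≤ (layers-nonNeg n w 0≤w) (≤-layers n (shift w) (λ j → 0≤w (suc j)) j≤n))

  -- One of n and n + 1 is even, and j is half of it; hence the recursion in steps of two.
  ∃-middle : ∀ n → ∃[ j ] (j ℕ.≤ n × Middle n j)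
  ∃-middle 0 = 0 , z≤n , z≤n , s≤s z≤n
  ∃-middle 1 = 1 , s≤s z≤n , s≤s z≤n , s≤s (s≤s (s≤s z≤n))
  ∃-middle (suc (suc n)) with ∃-middle n
  ... | j , j≤n , n≤ , <n = suc j , s≤s (ℕ.m≤n⇒m≤1+n j≤n) ,
    subst (2 ℕ.+ n ℕ.≤_) (sym (2*suc j)) (s≤s (s≤s n≤)) ,
    subst (ℕ._< 4 ℕ.+ n) (sym (2*suc j)) (s≤s (s≤s <n))

  -- Makes the number of terms positive, so that it can be cancelled from the two edge bounds.
  minterms>0 : ∀ n → 1ℤ ≤ layers n (mid n)
  minterms>0 n with ∃-middle n
  ... | j , j≤n , p = ℤ.≤-trans (hit (middle? n j)) (≤-layers n (mid n) (mid-≥0 n) j≤n)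
    where
    hit : (d : Dec (Middle n j)) → 1ℤ ≤ χ (does d)
    hit (yes _) = ℤ.≤-refl
    hit (no ¬p) = contradiction p ¬p

  -- With T sensitive edges, 3nN ≤ 20T and 20nkT ≤ k(n² + 100k³)N combine to 3n² ≤ n² + 100k³, that
  -- is n² ≤ 50k³.
  n²≤64k³-large : ∀ m k → .{{_ : ℕ.NonZero k}} → (C : MAJ∘MAJ-Circuit k (2 ℕ.+ m)) →
    9 ℕ.* length (minMaxTerms (2 ℕ.+ m)) ℕ.≤ 10 ℕ.* length (correctTerms C) → 2 ℕ.* k ℕ.≤ 2 ℕ.+ m →
    (2 ℕ.+ m) ℕ.* (2 ℕ.+ m) ℕ.≤ 64 ℕ.* (k ℕ.* k ℕ.* k)
  n²≤64k³-large m k@(suc _) C mostly 2k≤n′ = ℤ.drop‿+≤+ (subst₂ _≤_ (sym (ℤ.pos-* n′ n′)) cast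
    (ℤ.≤-trans (ℤ.*-cancelˡ-≤-pos (n″ * n″) (+ 50 * k³) (+ 2) doubled)
      -- 50 is relaxed to 64, a perfect cube, so that the final constant is rational.
      (ℤ.*-monoʳ-≤-nonNeg k³ {{nonNegative 0≤k³}} (+≤+ (ℕ.≤ᵇ⇒≤ 50 64 _)))))
    where
    n′ = 2 ℕ.+ m
    n″ = + n′
    k³ = + k * + k * + k
    w = mid n′
    T = sum (edges w (χ ∘ evalCircuit C))
    N = layers n′ w + layers n′ (shift w)
    0≤k³ : 0ℤ ≤ k³
    0≤k³ = +≤+ z≤n
    cast : + 64 * k³ ≡ + (64 ℕ.* (k ℕ.* k ℕ.* k))
    cast = sym (trans (ℤ.pos-* 64 (k ℕ.* k ℕ.* k)) (cong (λ z → + 64 * z)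
      (trans (ℤ.pos-* (k ℕ.* k) k) (cong (λ z → z * + k) (ℤ.pos-* k k)))))
    0<N : 0ℤ < N
    0<N = ℤ.<-≤-trans (+<+ (s≤s z≤n))
      (ℤ.+-mono-≤ (minterms>0 n′) (layers-nonNeg n′ (shift w) (λ j → mid-≥0 n′ (suc j))))
    many : + 3 * (n″ * N) ≤ + 20 * T
    many = edges-many n′ (evalCircuit C) (s≤s (s≤s z≤n)) (subst₂ _≤_
      (trans (ℤ.pos-* 9 (length (minMaxTerms n′))) (cong (λ z → + 9 * z) (length-minMaxTerms (suc m))))
      (trans (ℤ.pos-* 10 (length (correctTerms C))) (cong (λ z → + 10 * z) (length-correctTerms C)))
      (+≤+ mostly))
    few : + 20 * n″ * + k * T ≤ + k * ((n″ * n″ + + 100 * k³) * N)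
    few = circuit-influence m w (mid-≥0 n′) C (subst (_≤ n″) (ℤ.pos-* 2 k) (+≤+ 2k≤n′))
    tripled : + 3 * (n″ * n″) ≤ n″ * n″ + + 100 * k³
    -- Both edge bounds are compared after multiplication by k N, which is positive.
    tripled = ℤ.*-cancelʳ-≤-pos _ _ N {{positive 0<N}} (ℤ.*-cancelˡ-≤-pos _ _ (+ k) (begin
      + k * (+ 3 * (n″ * n″) * N)          ≡⟨ regroupˡ (+ k) n″ N ⟩
      n″ * + k * (+ 3 * (n″ * N))          ≤⟨ ℤ.*-monoˡ-≤-nonNeg (n″ * + k) many ⟩
      n″ * + k * (+ 20 * T)                ≡⟨ regroupʳ (+ k) n″ T ⟩
      + 20 * n″ * + k * T                  ≤⟨ few ⟩
      + k * ((n″ * n″ + + 100 * k³) * N)   ∎))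
      where
      open ℤ.≤-Reasoning
      regroupˡ : ∀ k n N → k * (+ 3 * (n * n) * N) ≡ n * k * (+ 3 * (n * N))
      regroupˡ = solve-∀
      regroupʳ : ∀ k n T → n * k * (+ 20 * T) ≡ + 20 * n * k * T
      regroupʳ = solve-∀
    doubled : + 2 * (n″ * n″) ≤ + 2 * (+ 50 * k³)
    doubled = certify-≤ (split n″ k³) (ℤ.i≤j⇒0≤j-i tripled)
      where
      split : ∀ n c → + 2 * (+ 50 * c) ≡ + 2 * (n * n) + (n * n + + 100 * c - + 3 * (n * n))
      split = solve-∀

-- Passage between rationals and natural numbers.

open Counting using (n²≤64k³-large)
open import Data.Rational.Base as ℚ using (ℚ; 0ℚ; 1ℚ; _/_; _-_; _<_)
import Data.Rational.Properties as ℚ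
open import Data.Rational.Unnormalised.Base as ℚᵘ using (mkℚᵘ)
import Data.Rational.Unnormalised.Properties as ℚᵘ

-- `ℕ→ℚ m` is normalised by a gcd that does not compute for variable m, whereas the unnormalised
-- fraction shows its numerator and denominator.
toℚᵘ-ℕ→ℚ : ∀ m → ℚ.toℚᵘ (ℕ→ℚ m) ℚᵘ.≃ mkℚᵘ (+ m) 0
toℚᵘ-ℕ→ℚ m = ℚ.toℚᵘ-fromℚᵘ (mkℚᵘ (+ m) 0)

ℕ→ℚ-* : ∀ m n → ℕ→ℚ (m ℕ.* n) ≡ ℕ→ℚ m ℚ.* ℕ→ℚ n
ℕ→ℚ-* m n = ℚ.toℚᵘ-injective (begin
  ℚ.toℚᵘ (ℕ→ℚ (m ℕ.* n))                   ≈⟨ toℚᵘ-ℕ→ℚ (m ℕ.* n) ⟩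
  mkℚᵘ (+ (m ℕ.* n)) 0                     ≡⟨ cong (λ z → mkℚᵘ z 0) (ℤ.pos-* m n) ⟩
  mkℚᵘ (+ m) 0 ℚᵘ.* mkℚᵘ (+ n) 0           ≈⟨ ℚᵘ.*-cong (toℚᵘ-ℕ→ℚ m) (toℚᵘ-ℕ→ℚ n) ⟨
  ℚ.toℚᵘ (ℕ→ℚ m) ℚᵘ.* ℚ.toℚᵘ (ℕ→ℚ n)       ≈⟨ ℚ.toℚᵘ-homo-* (ℕ→ℚ m) (ℕ→ℚ n) ⟨
  ℚ.toℚᵘ (ℕ→ℚ m ℚ.* ℕ→ℚ n)                 ∎)
  where open import Relation.Binary.Reasoning.Setoid ℚᵘ.≃-setoid

toℚᵘ-scaled : ∀ p m → ℚ.toℚᵘ (p ℚ.* ℕ→ℚ m) ℚᵘ.≃ ℚ.toℚᵘ p ℚᵘ.* mkℚᵘ (+ m) 0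
toℚᵘ-scaled p m = ℚᵘ.≃-trans (ℚ.toℚᵘ-homo-* p (ℕ→ℚ m)) (ℚᵘ.*-congˡ {ℚ.toℚᵘ p} (toℚᵘ-ℕ→ℚ m))

9/10-correct : ∀ (ε : ℚ) a b → ε < + 1 / 10 → (1ℚ - ε) ℚ.* ℕ→ℚ a ℚ.≤ ℕ→ℚ b → 9 ℕ.* a ℕ.≤ 10 ℕ.* b
9/10-correct ε a b ε<1/10 correct = ℤ.drop‿+≤+ (subst₂ ℤ._≤_
  (trans (ℤ.*-identityʳ _) (sym (ℤ.pos-* 9 a))) (trans (ℤ.*-comm (+ b) (+ 10)) (sym (ℤ.pos-* 10 b)))
  (ℚᵘ.drop-*≤* (ℚᵘ.≤-respˡ-≃ (toℚᵘ-scaled (+ 9 / 10) a) (ℚᵘ.≤-respʳ-≃ (toℚᵘ-ℕ→ℚ b) (ℚ.toℚᵘ-mono-≤ bound)))))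
  where
  9/10≤ : + 9 / 10 ℚ.≤ 1ℚ - ε
  9/10≤ = ℚ.<⇒≤ (ℚ.+-monoʳ-< 1ℚ (ℚ.neg-antimono-< ε<1/10))
  bound : (+ 9 / 10) ℚ.* ℕ→ℚ a ℚ.≤ ℕ→ℚ b
  bound = ℚ.≤-trans (ℚ.*-monoʳ-≤-nonNeg (ℕ→ℚ a) {{ℚ.normalize-nonNeg a 1}} 9/10≤) correct

-- The cube of 1/4 evaluates to 1/64, so the cubed goal is the hypothesis divided by 64.
from-ℕ : ∀ n k → n ℕ.* n ℕ.≤ 64 ℕ.* (k ℕ.* k ℕ.* k) → k ≥ + 1 / 4 · n ^⅔
from-ℕ n k n²≤64k³ = subst₂ (λ p q → (+ 1 / 64) ℚ.* p ℚ.≤ q) square cube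
  (ℚ.toℚᵘ-cancel-≤ (ℚᵘ.≤-respˡ-≃ (ℚᵘ.≃-sym (toℚᵘ-scaled (+ 1 / 64) (n ℕ.* n)))
    (ℚᵘ.≤-respʳ-≃ (ℚᵘ.≃-sym (toℚᵘ-ℕ→ℚ (k ℕ.* k ℕ.* k))) (ℚᵘ.*≤* (subst₂ ℤ._≤_
      (sym (trans (ℤ.*-identityʳ _) (ℤ.*-identityˡ _)))
      (trans (ℤ.pos-* 64 (k ℕ.* k ℕ.* k)) (ℤ.*-comm (+ 64) (+ (k ℕ.* k ℕ.* k))))
      (ℤ.+≤+ n²≤64k³))))))
  where
  square : ℕ→ℚ (n ℕ.* n) ≡ ℕ→ℚ n ^ℚ 2
  square = trans (ℕ→ℚ-* n n) (cong (λ z → ℕ→ℚ n ℚ.* z) (sym (ℚ.*-identityʳ (ℕ→ℚ n))))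
  cube : ℕ→ℚ (k ℕ.* k ℕ.* k) ≡ ℕ→ℚ k ^ℚ 3
  cube = trans (cong ℕ→ℚ (ℕ.*-assoc k k k)) (trans (ℕ→ℚ-* k (k ℕ.* k)) (cong (λ z → ℕ→ℚ k ℚ.* z)
    (trans (ℕ→ℚ-* k k) (cong (λ z → ℕ→ℚ k ℚ.* z) (sym (ℚ.*-identityʳ (ℕ→ℚ k)))))))

-- Case distinction between small and large n.

n²≤64k³-small : ∀ n k → .{{_ : NonZero k}} → n ℕ.≤ 2 ℕ.* k → n ℕ.* n ℕ.≤ 64 ℕ.* (k ℕ.* k ℕ.* k)
n²≤64k³-small n k n≤2k = begin
  n ℕ.* n                      ≤⟨ ℕ.*-mono-≤ n≤2k n≤2k ⟩
  2 ℕ.* k ℕ.* (2 ℕ.* k)        ≡⟨ ℕ.[m*n]*[o*p]≡[m*o]*[n*p] 2 k 2 k ⟩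
  -- As k ≥ 1, one more factor k can only increase the bound.
  4 ℕ.* (k ℕ.* k)              ≤⟨ ℕ.*-mono-≤ (ℕ.≤ᵇ⇒≤ 4 64 _) (ℕ.m≤m*n (k ℕ.* k) k) ⟩
  64 ℕ.* (k ℕ.* k ℕ.* k)       ∎
  where open ℕ.≤-Reasoning

-- The edge argument works for n ≥ 2 and 2k ≤ n. Otherwise n ≤ 2k, which covers n = 1 because k ≥ 1,
-- and then k is already linear in n.
n²≤64k³ : ∀ n k → .{{_ : NonZero n}} → .{{_ : NonZero k}} → (C : MAJ∘MAJ-Circuit k n) →
  9 ℕ.* length (minMaxTerms n) ℕ.≤ 10 ℕ.* length (correctTerms C) → n ℕ.* n ℕ.≤ 64 ℕ.* (k ℕ.* k ℕ.* k)
n²≤64k³ 1 k C _ = n²≤64k³-small 1 k (ℕ.≤-trans (ℕ.>-nonZero⁻¹ k) (ℕ.m≤n*m k 2))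
n²≤64k³ (suc (suc m)) k C mostly = [ n²≤64k³-small (2 ℕ.+ m) k , n²≤64k³-large m k C mostly ]′
  (ℕ.≤-total (2 ℕ.+ m) (2 ℕ.* k))

theorem10 : ∃[ c ] (0ℚ < c ×
    ((n k : ℕ) .{{_ : NonZero n}} .{{_ : NonZero k}} (ε : ℚ) → ε < + 1 / 10 →
    (Σ[ C ∈ MAJ∘MAJ-Circuit k n ] (C computesMAJOnFraction (1ℚ - ε))) →
    k ≥ c · n ^⅔))
theorem10 = + 1 / 4 , from-yes (0ℚ ℚ.<? + 1 / 4) , λ n k ε ε<1/10 (C , correct) →
  from-ℕ n k (n²≤64k³ n k C
    (9/10-correct ε (length (minMaxTerms n)) (length (correctTerms C)) ε<1/10 correct))
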